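{- Let $p\ge5$ be a prime. The Vieta graph of the cubic $x^2+y^2+z^2=xyz+D$ over $\mathbb{F}_p$ satisfies the following. (a) If $D=0$: there are $p^2+1+3\sigma(-1)p$ vertices in total, of which $3p-11-3\sigma(-1)$ are deficient; there are $3\big(p-4-\sigma(-1)\big)$ vertices of degree $2$, $0$ of degree $1$, and $1$ of degree $0$. (b) If $D=-4$: there are $p^2+1+\big(3+\sigma(-1)\big)\sigma(-2)p$ vertices in total, of which $3\big(p-4-\sigma(-1)+\sigma(-2)\varphi_2(1)\big)$ are deficient; there are $3\big(p-5-2\sigma(-1)+\sigma(-2)\varphi_2(1)\big)$ vertices of degree $2$, $3\big(1+\sigma(-1)\big)$ of degree $1$, and $0$ of degree $0$. (c) If $D=2$: there are $p^2+1+\big(3+\sigma(2)\big)\sigma(-2)p$ vertices in total, of which $3\big(p-4-\sigma(2)+\varphi_2(1)\big)$ are deficient; there are $3\big(p-5-2\sigma(2)+\varphi_2(1)\big)$ vertices of degree $2$, $3\big(1+\sigma(2)\big)$ of degree $1$, and $0$ of degree $0$. (d) If $D=8$: there are $p^2+1+\big(3+\sigma(2)\big)p$ vertices in total, of which $3\big(p-4-\sigma(2)+\sigma(2)\varphi_2(1)\big)$ are deficient; there are $3\big(p-5-2\sigma(2)+\sigma(2)\varphi_2(1)\big)$ vertices of degree $2$, $3\big(1+\sigma(2)\big)$ of degree $1$, and $0$ of degree $0$.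
   Context: $\sigma:\mathbb{F}_p\to\{ -1,0,1\}\subset\mathbb{Z}$ denotes the quadratic character: $\sigma(a)=1$ if $a$ is a nonzero square, $\sigma(a)=-1$ if $a$ is a non-square, $\sigma(0)=0$. The Jacobsthal sum is $\varphi_2(1)=\sum_{x\in\mathbb{F}_p}\sigma(x^3+x)$. The Vieta graph of the equation $x^2+y^2+z^2=xyz+D$ over $\mathbb{F}_p$ is the finite simple graph whose vertices are the solutions $(x,y,z)\in\mathbb{F}_p^3$, where two distinct vertices are joined by an edge whenever one is a Vieta flip of the other. The Vieta flips of $(x,y,z)$ are $(yz-x,y,z)$, $(x,xz-y,z)$, $(x,y,xy-z)$. Every vertex has degree at most $3$; a vertex is deficient if its degree is less than $3$. -}

module Defs where

import Algebra.Properties.CommutativeMonoid.Sum as Sum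
open import Data.Fin using (Fin; toℕ; fromℕ<)
open import Data.Fin.Properties using (any?) renaming (_≟_ to _≟ᶠ_)
open import Data.Integer as ℤ using (ℤ; 0ℤ; 1ℤ; -1ℤ)
open import Data.Integer.DivMod using (_%ℕ_; n%ℕd<d)
open import Data.Integer.Properties using (+-0-commutativeMonoid)
open import Data.List using (List; []; _∷_; length; filter; allFin; cartesianProduct)
open import Data.List.Membership.Propositional using (_∈_)
import Data.List.Membership.DecPropositional as DecMembership
open import Data.List.Relation.Unary.Unique.Propositional using (Unique)
open import Data.List.Relation.Unary.Unique.Propositional.Properties
  using (allFin⁺; cartesianProduct⁺; filter⁺)
open import Data.Nat as ℕ using (ℕ; NonZero)
open import Data.Nat.DivMod using (_mod_)
open import Data.Product using (_×_; _,_; ∃-syntax)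
open import Data.Product.Properties using (≡-dec)
open import Data.Sum using (_⊎_; swap)
open import Level using (0ℓ)
open import Relation.Binary using (Rel; Decidable; DecidableEquality; Symmetric)
open import Relation.Binary.PropositionalEquality using (_≡_; _≢_; refl; ≢-sym)
open import Relation.Nullary using (¬_; Dec; yes; no)
open import Relation.Nullary.Decidable using (¬?; _×-dec_; _⊎-dec_)

-- The vertex set is the set of entries of a duplicate-free list in an
-- ambient type A; adjacency is only used between listed vertices.
record FiniteSimpleGraph (A : Set) : Set₁ where
  field
    vertices : List A
    unique   : Unique vertices
    Adj      : Rel A 0ℓ
    adj?     : Decidable Adj
    symAdj   : Symmetric Adj
    irrefl   : ∀ {v} → ¬ Adj v v

  order : ℕ
  order = length vertices

  degree : A → ℕ
  degree v = length (filter (adj? v) vertices)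

  #ofDegree : ℕ → ℕ
  #ofDegree k = length (filter (λ v → degree v ℕ.≟ k) vertices)

  Deficient : A → Set
  Deficient v = degree v ℕ.< 3

  deficient? : ∀ v → Dec (Deficient v)
  deficient? v = degree v ℕ.<? 3

  #deficient : ℕ
  #deficient = length (filter deficient? vertices)

open FiniteSimpleGraph public using (order; #ofDegree; #deficient)

-- Arithmetic modulo p on the representatives 0, …, p − 1; for p prime, 𝔽 is
-- the field with p elements. In _-ₚ_ the truncated p ∸ toℕ y is exact, as toℕ y < p.
module Mod (p : ℕ) .{{_ : NonZero p}} where

  𝔽 : Set
  𝔽 = Fin p

  infixl 6 _+ₚ_ _-ₚ_
  infixl 7 _*ₚ_

  _+ₚ_ _*ₚ_ _-ₚ_ : 𝔽 → 𝔽 → 𝔽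

  x +ₚ y = (toℕ x ℕ.+ toℕ y) mod p
  x *ₚ y = (toℕ x ℕ.* toℕ y) mod p
  x -ₚ y = (toℕ x ℕ.+ (p ℕ.∸ toℕ y)) mod p

  -- Reduction ℤ → ℤ/p (_%ℕ_ returns the remainder in [0, p), also for
  -- negative integers).
  ι : ℤ → 𝔽
  ι n = fromℕ< (n%ℕd<d n p)

  IsSquare : 𝔽 → Set
  IsSquare a = ∃[ b ] b *ₚ b ≡ a

  isSquare? : ∀ a → Dec (IsSquare a)
  isSquare? a = any? (λ b → b *ₚ b ≟ᶠ a)

  σ : 𝔽 → ℤ
  σ a with a ≟ᶠ ι 0ℤ | isSquare? a
  ... | yes _ | _     = 0ℤ
  ... | no  _ | yes _ = 1ℤ
  ... | no  _ | no  _ = -1ℤ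

  -- The Jacobsthal sum φ₂(1).
  φ₂⟨1⟩ : ℤ
  φ₂⟨1⟩ = Sum.sum +-0-commutativeMonoid (λ (x : 𝔽) → σ (x *ₚ x *ₚ x +ₚ x))

  Triple : Set
  Triple = 𝔽 × 𝔽 × 𝔽

  _≟ᵗ_ : DecidableEquality Triple
  _≟ᵗ_ = ≡-dec _≟ᶠ_ (≡-dec _≟ᶠ_ _≟ᶠ_)

  open DecMembership _≟ᵗ_ using (_∈?_)

  triples : List Triple
  triples = cartesianProduct (allFin p) (cartesianProduct (allFin p) (allFin p))

  IsSolution : 𝔽 → Triple → Set
  IsSolution D (x , y , z) =
    x *ₚ x +ₚ y *ₚ y +ₚ z *ₚ z ≡ x *ₚ y *ₚ z +ₚ D

  isSolution? : ∀ D v → Dec (IsSolution D v)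
  isSolution? D (x , y , z) =
    x *ₚ x +ₚ y *ₚ y +ₚ z *ₚ z ≟ᶠ x *ₚ y *ₚ z +ₚ D

  flips : Triple → List Triple
  flips (x , y , z) =
    (y *ₚ z -ₚ x , y , z) ∷ (x , x *ₚ z -ₚ y , z) ∷ (x , y , x *ₚ y -ₚ z) ∷ []

  VietaAdj : Rel Triple 0ℓ
  VietaAdj v w = v ≢ w × (w ∈ flips v ⊎ v ∈ flips w)

  vietaGraph : 𝔽 → FiniteSimpleGraph Triple
  vietaGraph D = record
    { vertices = filter (isSolution? D) triples
    ; unique   = filter⁺ (isSolution? D)
        (cartesianProduct⁺ (allFin⁺ p) (cartesianProduct⁺ (allFin⁺ p) (allFin⁺ p)))
    ; Adj      = VietaAdj
    ; adj?     = λ v w → ¬? (v ≟ᵗ w) ×-dec ((w ∈? flips v) ⊎-dec (v ∈? flips w))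
    ; symAdj   = λ (v≢w , flip) → ≢-sym v≢w , swap flip
    ; irrefl   = λ (v≢v , _) → v≢v refl
    }

{-# OPTIONS --safe #-}

-- A flip fixes (x, y, z) exactly when, say, y z = 2 x, and on such a solution the equation becomes
-- (y² - 4)(z² - 4) = 16 - 4 D; for D ≠ 4, two flips fix it only if it lies on a coordinate axis. Hence
-- inclusion–exclusion over the three flips gives all degree counts from the numbers of solutions fixed
-- by one, two and three flips. Completing squares turns these numbers, and the number of vertices,
-- into character sums of quadratics, which are elementary, except for the sum J(D) of
-- χ(t (t - 4)(t - D)) over t. The substitution u = x + 1/x (a 2-isogeny) identifies the Jacobsthal sum
-- with the sum of χ(u³ - 4u), to which J(-4), J(2) and J(8) reduce by translation and twisting.
module Submission where

open import Defs
import Algebra.Properties.Group as GroupProperties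
import Algebra.Properties.Semiring.Sum as SemiringSum
import Algebra.Solver.Ring
open import Algebra.Bundles using (AbelianGroup; CommutativeRing)
open import Algebra.Solver.Ring.AlmostCommutativeRing using (AlmostCommutativeRing; _-Raw-AlmostCommutative⟶_; fromCommutativeRing)
open import Algebra.Structures using (IsCommutativeRing)
open import Data.Bool using (if_then_else_)
open import Data.Empty using (⊥-elim)
open import Data.Fin using (Fin; zero; suc; punchIn; toℕ)
open import Data.Fin.Permutation using (permutation)
open import Data.Fin.Properties using (any?; punchInᵢ≢i; toℕ-injective; toℕ-fromℕ<; toℕ<n) renaming (_≟_ to _≟ᶠ_)
open import Data.Integer as ℤ using (ℤ; +_; -[1+_]; -_; _+_; _-_; _*_; _^_; 0ℤ; 1ℤ; -1ℤ)
open import Data.Integer.DivMod using (_%ℕ_; _/ℕ_; n%ℕd<d; a≡a%ℕn+[a/ℕn]*n)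
open import Data.Integer.Properties as ℤₚ using (+-*-semiring; +-*-commutativeRing)
open import Data.Integer.Tactic.RingSolver using (solve-∀)
open import Data.List using (List; []; _∷_; _++_; map; foldr; length; filter; tabulate; allFin; cartesianProduct)
open import Data.List.Membership.Propositional using (_∈_)
open import Data.List.Membership.Propositional.Properties using (∈-filter⁺; ∈-filter⁻; ∈-cartesianProduct⁺; ∈-allFin)
open import Data.List.Membership.Propositional.Properties.WithK using (unique∧set⇒bag)
open import Data.List.Relation.Binary.BagAndSetEquality using (∼bag⇒↭)
open import Data.List.Relation.Binary.Permutation.Propositional.Properties using (↭-length)
open import Data.List.Relation.Unary.All as All using (All; []; _∷_)
open import Data.List.Relation.Unary.All.Properties using (all-filter)
open import Data.List.Relation.Unary.AllPairs using (AllPairs; []; _∷_)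
import Data.List.Relation.Unary.AllPairs.Properties as AllPairs
open import Data.List.Relation.Unary.Any using (here; there)
open import Data.List.Relation.Unary.Unique.Propositional using (Unique)
import Data.Maybe as Maybe
open import Data.Nat as ℕ using (ℕ; zero; suc; NonZero; _≥_)
open import Data.Nat.Coprimality using (coprime-Bézout; prime⇒coprime)
open import Data.Nat.DivMod using (_%_; _mod_; [m+kn]%n≡m%n; m<n⇒m%n≡m)
open import Data.Nat.GCD using (module Bézout)
open import Data.Nat.Primality using (Prime)
import Data.Nat.Properties as ℕₚ
open import Data.Product using (_×_; _,_; ∃-syntax; proj₁; proj₂)
open import Data.Sum using (_⊎_; inj₁; inj₂; [_,_])
open import Function using (_∘_; id; mk⇔)
open import Relation.Binary.PropositionalEquality using (_≡_; _≢_; refl; sym; trans; cong; cong₂; subst; isEquivalence; module ≡-Reasoning)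
open import Relation.Nullary using (¬_; Dec; yes; no; does; contradiction)
open import Relation.Nullary.Decidable using (¬?; dec-true; dec-false; dec⇒maybe; decidable-stable)

open GroupProperties (AbelianGroup.group ℤₚ.+-0-abelianGroup) using () renaming (∙-cancelˡ to +-cancelˡ; ∙-cancelʳ to +-cancelʳ)
open SemiringSum +-*-semiring using (sum; sum-cong-≗; ∑-distrib-+; ∑-comm; sum-permute; sum-remove; sum-replicate-zero; *-distribˡ-sum)

-- Two flips that both move a solution change different coordinates, so they lead to different
-- solutions and the degree is 3 - m, with m the number of flips fixing the solution. Every count is
-- a function of m summed over all solutions. The cubic t (t - 4)(t - D) arises with t = y²: a
-- solution fixed by the first flip is determined by y and a root z of (y² - 4) z² = 4 (y² - D). At
-- D = 0 two roots of the cubic collide and the sum is elementary. The values D = -4, 2, 8 are those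
-- that put 0, 4, D in arithmetic progression in some order; centring the progression at 0 leaves s³
-- - h² s with common difference h = 4, 2, 4, so all three sums belong to quadratic twists of one
-- curve. The value D = 4 is the obstacle: the right-hand side 16 - 4 D vanishes there. The
-- character is given only by its values on squares and nonsquares, and its multiplicativity is
-- itself obtained by summation, without a primitive root or Euler's criterion.

private variable
  A B : Set
  n : ℕ

-- Indicator functions

𝟙 : Dec A → ℤ
𝟙 d = if does d then 1ℤ else 0ℤ

𝟙-true : (d : Dec A) → A → 𝟙 d ≡ 1ℤ
𝟙-true d a rewrite dec-true d a = refl

𝟙-false : (d : Dec A) → ¬ A → 𝟙 d ≡ 0ℤ
𝟙-false d ¬a rewrite dec-false d ¬a = refl

𝟙-cong : (d : Dec A) (e : Dec B) → (A → B) → (B → A) → 𝟙 d ≡ 𝟙 e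
𝟙-cong (yes a) e f g = sym (𝟙-true e (f a))
𝟙-cong (no ¬a) e f g = sym (𝟙-false e (¬a ∘ g))

-- The integer is an index, so that a product of indicators can be read as a conjunction by pattern
-- matching. Two such products are then equal as soon as the conjunctions imply each other.
data Indicates (A : Set) : ℤ → Set where
  holds : A   → Indicates A 1ℤ
  fails : ¬ A → Indicates A 0ℤ

𝟙-indicates : (d : Dec A) → Indicates A (𝟙 d)
𝟙-indicates (yes a) = holds a
𝟙-indicates (no ¬a) = fails ¬a

infixr 7 _⟨*⟩_

_⟨*⟩_ : ∀ {i j} → Indicates A i → Indicates B j → Indicates (A × B) (i * j)
holds a  ⟨*⟩ holds b  = holds (a , b)
holds _  ⟨*⟩ fails ¬b = fails (¬b ∘ proj₂)
fails ¬a ⟨*⟩ holds _  = fails (¬a ∘ proj₁)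
fails ¬a ⟨*⟩ fails _  = fails (¬a ∘ proj₁)

indicates-unique : ∀ {i j} → Indicates A i → Indicates B j → (A → B) → (B → A) → i ≡ j
indicates-unique (holds _)  (holds _)  _ _ = refl
indicates-unique (holds a)  (fails ¬b) f _ = contradiction (f a) ¬b
indicates-unique (fails ¬a) (holds b)  _ g = contradiction (g b) ¬a
indicates-unique (fails _)  (fails _)  _ _ = refl

𝟙-*-cong : (d : Dec A) {i j : ℤ} → (A → i ≡ j) → 𝟙 d * i ≡ 𝟙 d * j
𝟙-*-cong (yes a) f = cong (1ℤ *_) (f a)
𝟙-*-cong (no _)  f = refl

δ : Fin n → Fin n → ℤ
δ x y = 𝟙 (x ≟ᶠ y)

δ-refl : (x : Fin n) → δ x x ≡ 1ℤ
δ-refl x = 𝟙-true (x ≟ᶠ x) refl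

δ-≢ : {x y : Fin n} → x ≢ y → δ x y ≡ 0ℤ
δ-≢ {x = x} {y} = 𝟙-false (x ≟ᶠ y)

δ-indicates : (x y : Fin n) → Indicates (x ≡ y) (δ x y)
δ-indicates x y = 𝟙-indicates (x ≟ᶠ y)

δ-cong : {x y u v : Fin n} → (x ≡ y → u ≡ v) → (u ≡ v → x ≡ y) → δ x y ≡ δ u v
δ-cong {x = x} {y} {u} {v} = 𝟙-cong (x ≟ᶠ y) (u ≟ᶠ v)

-- Finite sums of integers

sum-single : (i : Fin n) (f : Fin n → ℤ) → (∀ j → j ≢ i → f j ≡ 0ℤ) → sum f ≡ f i
sum-single {suc n} i f f≡0 = begin
  sum f                              ≡⟨ sum-remove f ⟩
  f i + sum (λ j → f (punchIn i j))  ≡⟨ cong (λ s → f i + s) (sum-cong-≗ λ j → f≡0 (punchIn i j) (punchInᵢ≢i i j)) ⟩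
  f i + sum {n} (λ _ → 0ℤ)           ≡⟨ cong (λ s → f i + s) (sum-replicate-zero n) ⟩
  f i + 0ℤ                           ≡⟨ ℤₚ.+-identityʳ (f i) ⟩
  f i                                ∎
  where open ≡-Reasoning

sum-δ : (i : Fin n) (f : Fin n → ℤ) → sum (λ j → δ j i * f j) ≡ f i
sum-δ i f = begin
  sum (λ j → δ j i * f j)  ≡⟨ sum-single i (λ j → δ j i * f j) (λ j j≢i → cong (_* f j) (δ-≢ j≢i)) ⟩
  δ i i * f i              ≡⟨ cong (_* f i) (δ-refl i) ⟩
  1ℤ * f i                 ≡⟨ ℤₚ.*-identityˡ (f i) ⟩
  f i                      ∎
  where open ≡-Reasoning

sum-const : ∀ n c → sum {n} (λ _ → c) ≡ + n * c
sum-const zero    c = refl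
sum-const (suc n) c = begin
  c + sum {n} (λ _ → c)  ≡⟨ cong (λ s → c + s) (sum-const n c) ⟩
  c + + n * c            ≡⟨ ℤₚ.suc-* (+ n) c ⟨
  + suc n * c            ∎
  where open ≡-Reasoning

sum-nonpos : (f : Fin n → ℤ) → (∀ i → f i ℤ.≤ 0ℤ) → sum f ℤ.≤ 0ℤ
sum-nonpos {zero}  f f≤0 = ℤₚ.≤-refl
sum-nonpos {suc n} f f≤0 = ℤₚ.+-mono-≤ (f≤0 zero) (sum-nonpos (f ∘ suc) (f≤0 ∘ suc))

-- Splitting off the i-th term leaves a nonpositive remainder, which forces 0 ≤ `f i`.
sum-nonpos-≡0 : (f : Fin n → ℤ) → (∀ i → f i ℤ.≤ 0ℤ) → sum f ≡ 0ℤ → ∀ i → f i ≡ 0ℤ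
sum-nonpos-≡0 {suc n} f f≤0 Σf≡0 i = ℤₚ.≤-antisym (f≤0 i) (begin
  0ℤ                                 ≡⟨ Σf≡0 ⟨
  sum f                              ≡⟨ sum-remove f ⟩
  f i + sum (λ j → f (punchIn i j))  ≤⟨ ℤₚ.+-monoʳ-≤ (f i) (sum-nonpos _ (f≤0 ∘ punchIn i)) ⟩
  f i + 0ℤ                           ≡⟨ ℤₚ.+-identityʳ (f i) ⟩
  f i                                ∎)
  where open ℤₚ.≤-Reasoning

-- Every function of the number of true conditions among three that vanishes at 0 has this form in
-- the indicators i, j, k of the conditions.
symmetric : (c₁ c₂ c₃ i j k : ℤ) → ℤ
symmetric c₁ c₂ c₃ i j k = c₁ * (i + j + k) + c₂ * (i * j + j * k + k * i) + c₃ * (i * (j * k))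

-- Counting along lists

sumₗ : (A → ℤ) → List A → ℤ
sumₗ f = foldr (λ x s → f x + s) 0ℤ

sumₗ-++ : ∀ (f : A → ℤ) xs ys → sumₗ f (xs ++ ys) ≡ sumₗ f xs + sumₗ f ys
sumₗ-++ f []       ys = sym (ℤₚ.+-identityˡ (sumₗ f ys))
sumₗ-++ f (x ∷ xs) ys = trans (cong (λ s → f x + s) (sumₗ-++ f xs ys)) (sym (ℤₚ.+-assoc (f x) (sumₗ f xs) (sumₗ f ys)))

sumₗ-map : ∀ (f : B → ℤ) (g : A → B) xs → sumₗ f (map g xs) ≡ sumₗ (f ∘ g) xs
sumₗ-map f g []       = refl
sumₗ-map f g (x ∷ xs) = cong (λ s → f (g x) + s) (sumₗ-map f g xs)

sumₗ-cartesianProduct : ∀ (f : A × B → ℤ) xs ys →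
  sumₗ f (cartesianProduct xs ys) ≡ sumₗ (λ x → sumₗ (λ y → f (x , y)) ys) xs
sumₗ-cartesianProduct f []       ys = refl
sumₗ-cartesianProduct f (x ∷ xs) ys = trans
  (sumₗ-++ f (map (x ,_) ys) (cartesianProduct xs ys))
  (cong₂ _+_ (sumₗ-map f (x ,_) ys) (sumₗ-cartesianProduct f xs ys))

sumₗ-tabulate : ∀ (f : A → ℤ) (g : Fin n → A) → sumₗ f (tabulate g) ≡ sum (f ∘ g)
sumₗ-tabulate {n = zero}  f g = refl
sumₗ-tabulate {n = suc n} f g = cong (λ s → f (g zero) + s) (sumₗ-tabulate f (g ∘ suc))

sumₗ-filter : {P : A → Set} (P? : ∀ x → Dec (P x)) (f : A → ℤ) → ∀ xs →
  sumₗ f (filter P? xs) ≡ sumₗ (λ x → 𝟙 (P? x) * f x) xs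
sumₗ-filter P? f []       = refl
sumₗ-filter P? f (x ∷ xs) with P? x
... | yes _ = cong₂ _+_ (sym (ℤₚ.*-identityˡ (f x))) (sumₗ-filter P? f xs)
... | no  _ = trans (sumₗ-filter P? f xs) (sym (ℤₚ.+-identityˡ (sumₗ (λ x → 𝟙 (P? x) * f x) xs)))

length-filter : {P : A → Set} (P? : ∀ x → Dec (P x)) → ∀ xs → + length (filter P? xs) ≡ sumₗ (λ x → 𝟙 (P? x)) xs
length-filter P? []       = refl
length-filter P? (x ∷ xs) with P? x
... | yes _ = cong (λ s → 1ℤ + s) (length-filter P? xs)
... | no  _ = trans (length-filter P? xs) (sym (ℤₚ.+-identityˡ (sumₗ (λ x → 𝟙 (P? x)) xs)))

-- For lists without repetition only after filtering: the distinctness of two entries may use that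
-- the first passes the filter. The flips of a vertex are of this kind, since two flips that both
-- fix it coincide.
unique-on : {P : A → Set} {xs : List A} → All P xs → AllPairs (λ x y → P x → x ≢ y) xs → Unique xs
unique-on []         []         = []
unique-on (px ∷ pxs) (rx ∷ rxs) = All.map (λ r → r px) rx ∷ unique-on pxs rxs

unique-length : {xs ys : List A} → Unique xs → Unique ys →
  (∀ {x} → x ∈ xs → x ∈ ys) → (∀ {x} → x ∈ ys → x ∈ xs) → length xs ≡ length ys
unique-length xs! ys! xs⊆ys ys⊆xs = ↭-length (∼bag⇒↭ (unique∧set⇒bag xs! ys! (mk⇔ xs⊆ys ys⊆xs)))

#failing : Dec A → ℕ
#failing (yes _) = 0
#failing (no _)  = 1

length-filter-¬ : {P : A → Set} (P? : ∀ x → Dec (P x)) → ∀ x xs →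
  length (filter (λ y → ¬? (P? y)) (x ∷ xs)) ≡ #failing (P? x) ℕ.+ length (filter (λ y → ¬? (P? y)) xs)
length-filter-¬ P? x xs with P? x
... | yes _ = refl
... | no  _ = refl

-- If m of the three conditions hold, the argument of `R?` is 3 - m, and `symmetric` takes the
-- values 0, c₁, 2 c₁ + c₂, 3 c₁ + 3 c₂ + c₃ for m = 0, 1, 2, 3. The four hypotheses on `R?` match
-- these values one by one.
#failing-symmetric : {R : ℕ → Set} (R? : ∀ k → Dec (R k)) (c₁ c₂ c₃ : ℤ) →
  𝟙 (R? 3) ≡ 0ℤ → 𝟙 (R? 2) ≡ c₁ → 𝟙 (R? 1) ≡ + 2 * c₁ + c₂ → 𝟙 (R? 0) ≡ + 3 * c₁ + + 3 * c₂ + c₃ →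
  {A B C : Set} (a : Dec A) (b : Dec B) (c : Dec C) →
  𝟙 (R? (#failing a ℕ.+ (#failing b ℕ.+ (#failing c ℕ.+ 0)))) ≡ symmetric c₁ c₂ c₃ (𝟙 a) (𝟙 b) (𝟙 c)
#failing-symmetric R? c₁ c₂ c₃ r₃ r₂ r₁ r₀ (no _) (no _) (no _) = trans r₃ (ring c₁ c₂ c₃)
  where
  ring : ∀ c₁ c₂ c₃ → 0ℤ ≡ c₁ * (0ℤ + 0ℤ + 0ℤ) + c₂ * (0ℤ * 0ℤ + 0ℤ * 0ℤ + 0ℤ * 0ℤ) + c₃ * (0ℤ * (0ℤ * 0ℤ))
  ring = solve-∀
#failing-symmetric R? c₁ c₂ c₃ r₃ r₂ r₁ r₀ (no _) (no _) (yes _) = trans r₂ (ring c₁ c₂ c₃)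
  where
  ring : ∀ c₁ c₂ c₃ → c₁ ≡ c₁ * (0ℤ + 0ℤ + 1ℤ) + c₂ * (0ℤ * 0ℤ + 0ℤ * 1ℤ + 1ℤ * 0ℤ) + c₃ * (0ℤ * (0ℤ * 1ℤ))
  ring = solve-∀
#failing-symmetric R? c₁ c₂ c₃ r₃ r₂ r₁ r₀ (no _) (yes _) (no _) = trans r₂ (ring c₁ c₂ c₃)
  where
  ring : ∀ c₁ c₂ c₃ → c₁ ≡ c₁ * (0ℤ + 1ℤ + 0ℤ) + c₂ * (0ℤ * 1ℤ + 1ℤ * 0ℤ + 0ℤ * 0ℤ) + c₃ * (0ℤ * (1ℤ * 0ℤ))
  ring = solve-∀
#failing-symmetric R? c₁ c₂ c₃ r₃ r₂ r₁ r₀ (no _) (yes _) (yes _) = trans r₁ (ring c₁ c₂ c₃)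
  where
  ring : ∀ c₁ c₂ c₃ → + 2 * c₁ + c₂ ≡ c₁ * (0ℤ + 1ℤ + 1ℤ) + c₂ * (0ℤ * 1ℤ + 1ℤ * 1ℤ + 1ℤ * 0ℤ) + c₃ * (0ℤ * (1ℤ * 1ℤ))
  ring = solve-∀
#failing-symmetric R? c₁ c₂ c₃ r₃ r₂ r₁ r₀ (yes _) (no _) (no _) = trans r₂ (ring c₁ c₂ c₃)
  where
  ring : ∀ c₁ c₂ c₃ → c₁ ≡ c₁ * (1ℤ + 0ℤ + 0ℤ) + c₂ * (1ℤ * 0ℤ + 0ℤ * 0ℤ + 0ℤ * 1ℤ) + c₃ * (1ℤ * (0ℤ * 0ℤ))
  ring = solve-∀
#failing-symmetric R? c₁ c₂ c₃ r₃ r₂ r₁ r₀ (yes _) (no _) (yes _) = trans r₁ (ring c₁ c₂ c₃)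
  where
  ring : ∀ c₁ c₂ c₃ → + 2 * c₁ + c₂ ≡ c₁ * (1ℤ + 0ℤ + 1ℤ) + c₂ * (1ℤ * 0ℤ + 0ℤ * 1ℤ + 1ℤ * 1ℤ) + c₃ * (1ℤ * (0ℤ * 1ℤ))
  ring = solve-∀
#failing-symmetric R? c₁ c₂ c₃ r₃ r₂ r₁ r₀ (yes _) (yes _) (no _) = trans r₁ (ring c₁ c₂ c₃)
  where
  ring : ∀ c₁ c₂ c₃ → + 2 * c₁ + c₂ ≡ c₁ * (1ℤ + 1ℤ + 0ℤ) + c₂ * (1ℤ * 1ℤ + 1ℤ * 0ℤ + 0ℤ * 1ℤ) + c₃ * (1ℤ * (1ℤ * 0ℤ))
  ring = solve-∀
#failing-symmetric R? c₁ c₂ c₃ r₃ r₂ r₁ r₀ (yes _) (yes _) (yes _) = trans r₀ (ring c₁ c₂ c₃)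
  where
  ring : ∀ c₁ c₂ c₃ → + 3 * c₁ + + 3 * c₂ + c₃ ≡ c₁ * (1ℤ + 1ℤ + 1ℤ) + c₂ * (1ℤ * 1ℤ + 1ℤ * 1ℤ + 1ℤ * 1ℤ) + c₃ * (1ℤ * (1ℤ * 1ℤ))
  ring = solve-∀

-- Character sums over a field of odd order

-- The arithmetic is kept abstract so that the ring solver meets only variables and constants
-- `⟦ n ⟧`, never remainders. The character is specified by its values on zero, squares and
-- nonsquares; multiplicativity is derived.
record OddFieldWithCharacter (q : ℕ) : Set where
  infixl 6 _⊕_ _⊝_
  infixl 7 _⊗_
  infix  8 ⊖_
  field
    _⊕_ _⊗_ : Fin q → Fin q → Fin q
    ⊖_      : Fin q → Fin q
    ⟦_⟧     : ℤ → Fin q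
    isCommutativeRing : IsCommutativeRing _≡_ _⊕_ _⊗_ ⊖_ ⟦ 0ℤ ⟧ ⟦ 1ℤ ⟧
    ⟦⟧-+    : ∀ m n → ⟦ m + n ⟧ ≡ ⟦ m ⟧ ⊕ ⟦ n ⟧
    ⟦⟧-*    : ∀ m n → ⟦ m * n ⟧ ≡ ⟦ m ⟧ ⊗ ⟦ n ⟧
    ⟦⟧-neg  : ∀ m → ⟦ - m ⟧ ≡ ⊖ ⟦ m ⟧
    inverse : ∀ a → a ≢ ⟦ 0ℤ ⟧ → ∃[ b ] b ⊗ a ≡ ⟦ 1ℤ ⟧
    2≢0     : ⟦ + 2 ⟧ ≢ ⟦ 0ℤ ⟧
    χ           : Fin q → ℤ
    χ-zero      : χ ⟦ 0ℤ ⟧ ≡ 0ℤ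
    χ-square    : ∀ b → b ≢ ⟦ 0ℤ ⟧ → χ (b ⊗ b) ≡ 1ℤ
    χ-nonsquare : ∀ {a} → (∀ b → b ⊗ b ≢ a) → χ a ≡ -1ℤ

  commutativeRing : CommutativeRing _ _
  commutativeRing = record { isCommutativeRing = isCommutativeRing }

  _⊝_ : Fin q → Fin q → Fin q
  x ⊝ y = x ⊕ ⊖ y

module CharacterSums {q : ℕ} (F : OddFieldWithCharacter q) where
  open OddFieldWithCharacter F
  open IsCommutativeRing isCommutativeRing using () renaming (zeroʳ to ⊗-zeroʳ; zeroˡ to ⊗-zeroˡ; *-comm to ⊗-comm)

  private
    0# 1# 4# : Fin q
    0# = ⟦ 0ℤ ⟧
    1# = ⟦ 1ℤ ⟧
    4# = ⟦ + 4 ⟧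

  ring : AlmostCommutativeRing _ _
  ring = fromCommutativeRing commutativeRing

  ⟦⟧-morphism : CommutativeRing.rawRing +-*-commutativeRing -Raw-AlmostCommutative⟶ ring
  ⟦⟧-morphism = record
    { ⟦_⟧    = ⟦_⟧
    ; +-homo = ⟦⟧-+
    ; *-homo = ⟦⟧-*
    ; -‿homo = ⟦⟧-neg
    ; 0-homo = refl
    ; 1-homo = refl
    }

  -- Coefficients are integers, compared in ℤ and carried over by `⟦_⟧`, so constants such as 4 or
  -- 16 normalise without q being known.
  open Algebra.Solver.Ring (CommutativeRing.rawRing +-*-commutativeRing) ring ⟦⟧-morphism
    (λ m n → Maybe.map (cong ⟦_⟧) (dec⇒maybe (m ℤ.≟ n)))
    using (solve; _:=_; _:+_; _:*_; :-_; _:-_; con)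

  -- Field arithmetic and changes of variable

  ∑ : (Fin q → ℤ) → ℤ
  ∑ = sum

  -- The way an equational hypothesis enters the ring solver: a - b is exhibited as the multiple k
  -- of l - r, and what remains is a polynomial identity.
  lincomb : ∀ {a b l r} k → l ≡ r → a ≡ b ⊕ k ⊗ (l ⊝ r) → a ≡ b
  lincomb {a} {b} {l} k refl eq = trans eq (solve 3 (λ b k l → b :+ k :* (l :- l) := b) refl b k l)

  lincomb₂ : ∀ {a b l r l′ r′} k k′ → l ≡ r → l′ ≡ r′ → a ≡ b ⊕ k ⊗ (l ⊝ r) ⊕ k′ ⊗ (l′ ⊝ r′) → a ≡ b
  lincomb₂ {a} {b} {l} {l′ = l′} k k′ refl refl eq =
    trans eq (solve 5 (λ b k l k′ l′ → b :+ k :* (l :- l) :+ k′ :* (l′ :- l′) := b) refl b k l k′ l′)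

  cancel : ∀ {a x y} → a ≢ 0# → a ⊗ x ≡ a ⊗ y → x ≡ y
  cancel {a} {x} {y} a≢0 ax≡ay with inverse a a≢0
  ... | b , ba≡1 = lincomb₂ (y ⊝ x) b ba≡1 ax≡ay
    (solve 4 (λ a b x y → x := y :+ (y :- x) :* (b :* a :- con 1ℤ) :+ b :* (a :* x :- a :* y)) refl a b x y)

  ⊗-≢0 : ∀ {a b} → a ≢ 0# → b ≢ 0# → a ⊗ b ≢ 0#
  ⊗-≢0 {a} a≢0 b≢0 ab≡0 = b≢0 (cancel a≢0 (trans ab≡0 (sym (⊗-zeroʳ a))))

  square-≢0 : ∀ {a b} → b ⊗ b ≡ a → a ≢ 0# → b ≢ 0#
  square-≢0 b²≡a a≢0 refl = a≢0 (trans (sym b²≡a) (⊗-zeroʳ 0#))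

  4≢0 : 4# ≢ 0#
  4≢0 = ⊗-≢0 2≢0 2≢0 ∘ trans (sym (⟦⟧-* (+ 2) (+ 2)))

  ⊝≡0⇒≡ : ∀ {a b} → a ⊝ b ≡ 0# → a ≡ b
  ⊝≡0⇒≡ {a} {b} eq = lincomb 1# eq (solve 2 (λ a b → a := b :+ con 1ℤ :* ((a :- b) :- con 0ℤ)) refl a b)

  square-roots : ∀ {x y} → x ⊗ x ≡ y ⊗ y → x ≡ y ⊎ x ≡ ⊖ y
  square-roots {x} {y} eq with (x ⊝ y) ≟ᶠ 0#
  ... | yes d≡0 = inj₁ (⊝≡0⇒≡ d≡0)
  ... | no  d≢0 = inj₂ (cancel d≢0 (lincomb 1# eq
    (solve 2 (λ x y → (x :- y) :* x := (x :- y) :* (:- y) :+ con 1ℤ :* (x :* x :- y :* y)) refl x y)))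

  -- An affine map with invertible slope permutes the field.
  ∑-reindex : ∀ {a} b f → a ≢ 0# → ∑ (λ x → f (a ⊗ x ⊕ b)) ≡ ∑ f
  ∑-reindex {a} b f a≢0 with inverse a a≢0
  ... | c , ca≡1 = sym (sum-permute f (permutation (λ x → a ⊗ x ⊕ b) (λ y → c ⊗ (y ⊝ b))
    (λ y → lincomb (y ⊝ b) ca≡1
      (solve 4 (λ a b c y → a :* (c :* (y :- b)) :+ b := y :+ (y :- b) :* (c :* a :- con 1ℤ)) refl a b c y))
    (λ x → lincomb x ca≡1
      (solve 4 (λ a b c x → c :* (a :* x :+ b :- b) := x :+ x :* (c :* a :- con 1ℤ)) refl a b c x))))

  ∑-scale : ∀ {a} f → a ≢ 0# → ∑ (λ x → f (a ⊗ x)) ≡ ∑ f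
  ∑-scale {a} f a≢0 = trans
    (sum-cong-≗ (λ x → cong f (solve 2 (λ a x → a :* x := a :* x :+ con 0ℤ) refl a x)))
    (∑-reindex 0# f a≢0)

  ∑δ≡1 : ∀ a → ∑ (λ x → δ x a) ≡ 1ℤ
  ∑δ≡1 a = trans (sum-single a (λ x → δ x a) (λ _ → δ-≢)) (δ-refl a)

  ∑-linear : ∀ {a} b c → a ≢ 0# → ∑ (λ x → δ (a ⊗ x ⊕ b) c) ≡ 1ℤ
  ∑-linear b c a≢0 = trans (∑-reindex b (λ y → δ y c) a≢0) (∑δ≡1 c)

  -- The bridge between counting roots and χ: zero has one root, a nonzero square b² has the two
  -- roots b and -b, which differ because 2 ≠ 0, and a nonsquare has none.
  ∑-square : ∀ a → ∑ (λ x → δ (x ⊗ x) a) ≡ 1ℤ + χ a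
  ∑-square a with a ≟ᶠ 0# | any? (λ b → b ⊗ b ≟ᶠ a)
  ... | yes refl | _ = begin
    ∑ (λ x → δ (x ⊗ x) 0#)  ≡⟨ sum-single 0# (λ x → δ (x ⊗ x) 0#) (λ x x≢0 → δ-≢ (⊗-≢0 x≢0 x≢0)) ⟩
    δ (0# ⊗ 0#) 0#          ≡⟨ 𝟙-true (0# ⊗ 0# ≟ᶠ 0#) (⊗-zeroʳ 0#) ⟩
    1ℤ                      ≡⟨ cong (λ s → 1ℤ + s) χ-zero ⟨
    1ℤ + χ 0#               ∎
    where open ≡-Reasoning
  ... | no a≢0 | yes (b , refl) = begin
    ∑ (λ x → δ (x ⊗ x) (b ⊗ b))            ≡⟨ sum-cong-≗ two-roots ⟩
    ∑ (λ x → δ x b + δ x (⊖ b))            ≡⟨ ∑-distrib-+ (λ x → δ x b) (λ x → δ x (⊖ b)) ⟩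
    ∑ (λ x → δ x b) + ∑ (λ x → δ x (⊖ b))  ≡⟨ cong₂ _+_ (∑δ≡1 b) (∑δ≡1 (⊖ b)) ⟩
    1ℤ + 1ℤ                                ≡⟨ cong (λ s → 1ℤ + s) (χ-square b b≢0) ⟨
    1ℤ + χ (b ⊗ b)                         ∎
    where
    open ≡-Reasoning
    b≢0 : b ≢ 0#
    b≢0 = square-≢0 refl a≢0
    b≢-b : b ≢ ⊖ b
    b≢-b eq = ⊗-≢0 2≢0 b≢0 (lincomb 1# eq
      (solve 1 (λ b → con (+ 2) :* b := con 0ℤ :+ con 1ℤ :* (b :- (:- b))) refl b))
    two-roots : ∀ x → δ (x ⊗ x) (b ⊗ b) ≡ δ x b + δ x (⊖ b)
    two-roots x with x ≟ᶠ b | x ≟ᶠ ⊖ b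
    ... | yes x≡b  | yes x≡-b = ⊥-elim (b≢-b (trans (sym x≡b) x≡-b))
    ... | yes refl | no  _    = δ-refl (x ⊗ x)
    ... | no  _    | yes refl = 𝟙-true (⊖ b ⊗ ⊖ b ≟ᶠ b ⊗ b) (solve 1 (λ b → :- b :* :- b := b :* b) refl b)
    ... | no  x≢b  | no x≢-b  = δ-≢ λ eq → [ x≢b , x≢-b ] (square-roots eq)
  ... | no _ | no nonsquare = begin
    ∑ (λ x → δ (x ⊗ x) a)  ≡⟨ sum-cong-≗ (λ x → δ-≢ λ eq → nonsquare (x , eq)) ⟩
    ∑ (λ _ → 0ℤ)           ≡⟨ sum-replicate-zero q ⟩
    0ℤ                     ≡⟨ cong (λ s → 1ℤ + s) (χ-nonsquare λ b eq → nonsquare (b , eq)) ⟨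
    1ℤ + χ a               ∎
    where open ≡-Reasoning

  ∑-+ : ∀ f g → ∑ (λ x → f x + g x) ≡ ∑ f + ∑ g
  ∑-+ = ∑-distrib-+

  ∑-* : ∀ c f → ∑ (λ x → c * f x) ≡ c * ∑ f
  ∑-* c f = sym (*-distribˡ-sum c f)

  ∑-swap : ∀ (f : Fin q → Fin q → ℤ) → ∑ (λ x → ∑ (f x)) ≡ ∑ (λ y → ∑ (λ x → f x y))
  ∑-swap = ∑-comm

  -- The fibre of squaring over t has 1 + χ t points.
  ∑-pullback-square : ∀ f → ∑ (λ x → f (x ⊗ x)) ≡ ∑ f + ∑ (λ t → χ t * f t)
  ∑-pullback-square f = begin
    ∑ (λ x → f (x ⊗ x))                      ≡⟨ sum-cong-≗ (λ x → sum-δ (x ⊗ x) f) ⟨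
    ∑ (λ x → ∑ (λ t → δ t (x ⊗ x) * f t))    ≡⟨ ∑-swap (λ x t → δ t (x ⊗ x) * f t) ⟩
    ∑ (λ t → ∑ (λ x → δ t (x ⊗ x) * f t))    ≡⟨ sum-cong-≗ fibre ⟩
    ∑ (λ t → f t + χ t * f t)                ≡⟨ ∑-+ f (λ t → χ t * f t) ⟩
    ∑ f + ∑ (λ t → χ t * f t)                ∎
    where
    open ≡-Reasoning
    fibre : ∀ t → ∑ (λ x → δ t (x ⊗ x) * f t) ≡ f t + χ t * f t
    fibre t = begin
      ∑ (λ x → δ t (x ⊗ x) * f t)  ≡⟨ sum-cong-≗ (λ x → trans (cong (_* f t) (δ-cong {x = t} sym sym)) (ℤₚ.*-comm (δ (x ⊗ x) t) (f t))) ⟩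
      ∑ (λ x → f t * δ (x ⊗ x) t)  ≡⟨ ∑-* (f t) (λ x → δ (x ⊗ x) t) ⟩
      f t * ∑ (λ x → δ (x ⊗ x) t)  ≡⟨ cong (λ s → f t * s) (∑-square t) ⟩
      f t * (1ℤ + χ t)             ≡⟨ distrib (f t) (χ t) ⟩
      f t + χ t * f t              ∎
      where
      distrib : ∀ i j → i * (1ℤ + j) ≡ i + j * i
      distrib = solve-∀

  -- The fibres of squaring have 1 + χ t points and together exhaust the q elements.
  ∑χ≡0 : ∑ χ ≡ 0ℤ
  ∑χ≡0 = +-cancelˡ (+ q * 1ℤ) (∑ χ) 0ℤ (begin
    + q * 1ℤ + ∑ χ                                 ≡⟨ cong₂ _+_ (sum-const q 1ℤ) (sum-cong-≗ (λ t → ℤₚ.*-identityʳ (χ t))) ⟨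
    ∑ (λ _ → 1ℤ) + ∑ (λ t → χ t * 1ℤ)              ≡⟨ ∑-pullback-square (λ _ → 1ℤ) ⟨
    ∑ (λ _ → 1ℤ)                                   ≡⟨ sum-const q 1ℤ ⟩
    + q * 1ℤ                                       ≡⟨ ℤₚ.+-identityʳ (+ q * 1ℤ) ⟨
    + q * 1ℤ + 0ℤ                                  ∎)
    where open ≡-Reasoning

  -- Multiplicativity of the quadratic character

  data Residue (a : Fin q) : Set where
    null      : a ≡ 0# → Residue a
    square    : ∀ b → b ≢ 0# → b ⊗ b ≡ a → Residue a
    nonsquare : a ≢ 0# → (∀ b → b ⊗ b ≢ a) → Residue a

  residue : ∀ a → Residue a
  residue a with a ≟ᶠ 0# | any? (λ b → b ⊗ b ≟ᶠ a)
  ... | yes a≡0 | _            = null a≡0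
  ... | no a≢0  | yes (b , eq) = square b (square-≢0 eq a≢0) eq
  ... | no a≢0  | no none      = nonsquare a≢0 (λ b eq → none (b , eq))

  1≢0 : 1# ≢ 0#
  1≢0 1≡0 = 2≢0 (lincomb ⟦ + 2 ⟧ 1≡0 (solve 0 (con (+ 2) := con 0ℤ :+ con (+ 2) :* (con 1ℤ :- con 0ℤ)) refl))

  χ-zero′ : ∀ {a} → a ≡ 0# → χ a ≡ 0ℤ
  χ-zero′ refl = χ-zero

  χ-square′ : ∀ {a} b → b ≢ 0# → b ⊗ b ≡ a → χ a ≡ 1ℤ
  χ-square′ b b≢0 refl = χ-square b b≢0

  χ-≤1 : ∀ a → χ a ℤ.≤ 1ℤ
  χ-≤1 a with residue a
  ... | null a≡0         rewrite χ-zero′ a≡0           = ℤ.+≤+ ℕ.z≤n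
  ... | square b b≢0 eq  rewrite χ-square′ b b≢0 eq    = ℤₚ.≤-refl
  ... | nonsquare _ none rewrite χ-nonsquare none      = ℤ.-≤+

  -- Dividing a root of b² a by b would give a root of a; `d` is the inverse of b.
  square⊗nonsquare : ∀ {a} b → b ≢ 0# → (∀ c → c ⊗ c ≢ a) → ∀ c → c ⊗ c ≢ b ⊗ b ⊗ a
  square⊗nonsquare {a} b b≢0 none c eq with inverse b b≢0
  ... | d , db≡1 = none (d ⊗ c) (lincomb₂ (d ⊗ d) (a ⊗ (d ⊗ b ⊕ 1#)) eq db≡1
    (solve 4 (λ a b c d → d :* c :* (d :* c) := a :+ d :* d :* (c :* c :- b :* b :* a)
                            :+ a :* (d :* b :+ con 1ℤ) :* (d :* b :- con 1ℤ)) refl a b c d))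

  χ-square-⊗ : ∀ {b} a → b ≢ 0# → χ (b ⊗ b ⊗ a) ≡ χ a
  χ-square-⊗ {b} a b≢0 with residue a
  ... | null refl        = cong χ (⊗-zeroʳ (b ⊗ b))
  ... | square c c≢0 refl = trans
    (χ-square′ (b ⊗ c) (⊗-≢0 b≢0 c≢0) (solve 2 (λ b c → b :* c :* (b :* c) := b :* b :* (c :* c)) refl b c))
    (sym (χ-square c c≢0))
  ... | nonsquare _ none = trans (χ-nonsquare (square⊗nonsquare b b≢0 none)) (sym (χ-nonsquare none))

  -- χ (a x) + χ x vanishes on squares x, is at most 0 elsewhere, and sums to 0 over x.
  nonsquare⊗nonsquare : ∀ {a b} → a ≢ 0# → (∀ c → c ⊗ c ≢ a) → (∀ c → c ⊗ c ≢ b) → χ (a ⊗ b) ≡ 1ℤ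
  nonsquare⊗nonsquare {a} {b} a≢0 a-none b-none =
    +-cancelʳ -1ℤ (χ (a ⊗ b)) 1ℤ (trans (cong (λ s → χ (a ⊗ b) + s) (sym (χ-nonsquare b-none))) (sum-nonpos-≡0 g g≤0 Σg≡0 b))
    where
    g : Fin q → ℤ
    g x = χ (a ⊗ x) + χ x
    g≤0 : ∀ x → g x ℤ.≤ 0ℤ
    g≤0 x with residue x
    ... | null refl         = ℤₚ.≤-reflexive (cong₂ _+_ (χ-zero′ (⊗-zeroʳ a)) χ-zero)
    ... | square c c≢0 refl = ℤₚ.≤-reflexive (cong₂ _+_
      (trans (cong χ (⊗-comm a (c ⊗ c))) (trans (χ-square-⊗ a c≢0) (χ-nonsquare a-none))) (χ-square c c≢0))
    ... | nonsquare _ none  = ℤₚ.+-mono-≤ (χ-≤1 (a ⊗ x)) (ℤₚ.≤-reflexive (χ-nonsquare none))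
    Σg≡0 : ∑ g ≡ 0ℤ
    Σg≡0 = trans (∑-+ (λ x → χ (a ⊗ x)) χ) (cong₂ _+_ (trans (∑-scale χ a≢0) ∑χ≡0) ∑χ≡0)

  -- Factors that are zero or square are absorbed directly. Only the product of two nonsquares needs
  -- the summation argument.
  χ-⊗ : ∀ a b → χ (a ⊗ b) ≡ χ a * χ b
  χ-⊗ a b with residue a | residue b
  ... | null refl | _ = trans (χ-zero′ (⊗-zeroˡ b)) (cong (_* χ b) (sym χ-zero))
  ... | square c c≢0 refl | _ = trans (χ-square-⊗ b c≢0)
    (trans (sym (ℤₚ.*-identityˡ (χ b))) (cong (_* χ b) (sym (χ-square c c≢0))))
  ... | nonsquare _ _ | null refl = trans (χ-zero′ (⊗-zeroʳ a))
    (trans (sym (ℤₚ.*-zeroʳ (χ a))) (cong (λ s → χ a * s) (sym χ-zero)))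
  ... | nonsquare _ _ | square c c≢0 refl = trans (cong χ (⊗-comm a (c ⊗ c))) (trans (χ-square-⊗ a c≢0)
    (trans (sym (ℤₚ.*-identityʳ (χ a))) (cong (λ s → χ a * s) (sym (χ-square c c≢0)))))
  ... | nonsquare a≢0 a-none | nonsquare _ b-none = trans (nonsquare⊗nonsquare a≢0 a-none b-none)
    (sym (cong₂ _*_ (χ-nonsquare a-none) (χ-nonsquare b-none)))

  -- Sums over the values of quadratic polynomials

  χ4≡1 : χ 4# ≡ 1ℤ
  χ4≡1 = χ-square′ ⟦ + 2 ⟧ 2≢0 (sym (⟦⟧-* (+ 2) (+ 2)))

  χ-4⊗ : ∀ a → χ (4# ⊗ a) ≡ χ a
  χ-4⊗ a = trans (cong (λ f → χ (f ⊗ a)) (⟦⟧-* (+ 2) (+ 2))) (χ-square-⊗ a 2≢0)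

  -- Multiplying by 4 completes the square: y = 2 x - b satisfies y² = b² - 4 c.
  ∑-quadratic : ∀ b c → ∑ (λ x → δ (x ⊗ x ⊕ c) (b ⊗ x)) ≡ 1ℤ + χ (b ⊗ b ⊝ 4# ⊗ c)
  ∑-quadratic b c = begin
    ∑ (λ x → δ (x ⊗ x ⊕ c) (b ⊗ x))  ≡⟨ sum-cong-≗ (λ x → δ-cong (complete x) (uncomplete x)) ⟩
    ∑ (λ x → f (⟦ + 2 ⟧ ⊗ x ⊕ ⊖ b))  ≡⟨ ∑-reindex (⊖ b) f 2≢0 ⟩
    ∑ f                              ≡⟨ ∑-square (b ⊗ b ⊝ 4# ⊗ c) ⟩
    1ℤ + χ (b ⊗ b ⊝ 4# ⊗ c)          ∎
    where
    open ≡-Reasoning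
    f : Fin q → ℤ
    f y = δ (y ⊗ y) (b ⊗ b ⊝ 4# ⊗ c)
    complete : ∀ x → x ⊗ x ⊕ c ≡ b ⊗ x → (⟦ + 2 ⟧ ⊗ x ⊕ ⊖ b) ⊗ (⟦ + 2 ⟧ ⊗ x ⊕ ⊖ b) ≡ b ⊗ b ⊝ 4# ⊗ c
    complete x eq = lincomb 4# eq (solve 3 (λ b c x →
      (con (+ 2) :* x :+ :- b) :* (con (+ 2) :* x :+ :- b) :=
      b :* b :- con (+ 4) :* c :+ con (+ 4) :* (x :* x :+ c :- b :* x)) refl b c x)
    uncomplete : ∀ x → (⟦ + 2 ⟧ ⊗ x ⊕ ⊖ b) ⊗ (⟦ + 2 ⟧ ⊗ x ⊕ ⊖ b) ≡ b ⊗ b ⊝ 4# ⊗ c → x ⊗ x ⊕ c ≡ b ⊗ x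
    uncomplete x eq = cancel 4≢0 (lincomb 1# eq (solve 3 (λ b c x →
      con (+ 4) :* (x :* x :+ c) := con (+ 4) :* (b :* x) :+ con 1ℤ :*
      ((con (+ 2) :* x :+ :- b) :* (con (+ 2) :* x :+ :- b) :- (b :* b :- con (+ 4) :* c))) refl b c x))

  ∑-scaled-square : ∀ {a} b → a ≢ 0# → ∑ (λ x → δ (a ⊗ (x ⊗ x)) b) ≡ 1ℤ + χ (a ⊗ b)
  ∑-scaled-square {a} b a≢0 = begin
    ∑ (λ x → δ (a ⊗ (x ⊗ x)) b)            ≡⟨ sum-cong-≗ (λ x → δ-cong (to x) (from x)) ⟩
    ∑ (λ x → δ (a ⊗ x ⊗ (a ⊗ x)) (a ⊗ b))  ≡⟨ ∑-scale (λ y → δ (y ⊗ y) (a ⊗ b)) a≢0 ⟩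
    ∑ (λ y → δ (y ⊗ y) (a ⊗ b))            ≡⟨ ∑-square (a ⊗ b) ⟩
    1ℤ + χ (a ⊗ b)                         ∎
    where
    open ≡-Reasoning
    to : ∀ x → a ⊗ (x ⊗ x) ≡ b → a ⊗ x ⊗ (a ⊗ x) ≡ a ⊗ b
    to x refl = solve 2 (λ a x → a :* x :* (a :* x) := a :* (a :* (x :* x))) refl a x
    from : ∀ x → a ⊗ x ⊗ (a ⊗ x) ≡ a ⊗ b → a ⊗ (x ⊗ x) ≡ b
    from x eq = cancel a≢0 (trans (solve 2 (λ a x → a :* (a :* (x :* x)) := a :* x :* (a :* x)) refl a x) eq)

  -- Counts y² - w² = d along the lines y = w + s: one point for each s ≠ 0.
  ∑-hyperbola : ∀ d → ∑ (λ w → ∑ (λ y → δ (w ⊗ w) (y ⊗ y ⊝ d))) ≡ + q - 1ℤ + + q * δ d 0#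
  ∑-hyperbola d = begin
    ∑ (λ w → ∑ (λ y → δ (w ⊗ w) (y ⊗ y ⊝ d)))                  ≡⟨ sum-cong-≗ line ⟨
    ∑ (λ w → ∑ (λ s → δ (⟦ + 2 ⟧ ⊗ s ⊗ w ⊕ 0#) (d ⊝ s ⊗ s)))   ≡⟨ ∑-swap (λ w s → δ (⟦ + 2 ⟧ ⊗ s ⊗ w ⊕ 0#) (d ⊝ s ⊗ s)) ⟩
    ∑ (λ s → ∑ (λ w → δ (⟦ + 2 ⟧ ⊗ s ⊗ w ⊕ 0#) (d ⊝ s ⊗ s)))   ≡⟨ sum-cong-≗ points ⟩
    ∑ (λ s → 1ℤ + δ s 0# * (+ q * δ d 0# - 1ℤ))                ≡⟨ ∑-+ (λ _ → 1ℤ) (λ s → δ s 0# * (+ q * δ d 0# - 1ℤ)) ⟩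
    ∑ (λ _ → 1ℤ) + ∑ (λ s → δ s 0# * (+ q * δ d 0# - 1ℤ))      ≡⟨ cong₂ _+_ (sum-const q 1ℤ) (sum-δ 0# (λ _ → + q * δ d 0# - 1ℤ)) ⟩
    + q * 1ℤ + (+ q * δ d 0# - 1ℤ)                             ≡⟨ rearrange (+ q) (δ d 0#) ⟩
    + q - 1ℤ + + q * δ d 0#                                    ∎
    where
    open ≡-Reasoning
    rearrange : ∀ i j → i * 1ℤ + (i * j - 1ℤ) ≡ i - 1ℤ + i * j
    rearrange = solve-∀
    line : ∀ w → ∑ (λ s → δ (⟦ + 2 ⟧ ⊗ s ⊗ w ⊕ 0#) (d ⊝ s ⊗ s)) ≡ ∑ (λ y → δ (w ⊗ w) (y ⊗ y ⊝ d))
    line w = trans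
      (sum-cong-≗ (λ s → δ-cong
        (λ eq → lincomb (⊖ 1#) eq (solve 3 (λ d s w →
          w :* w := (con 1ℤ :* s :+ w) :* (con 1ℤ :* s :+ w) :- d :+ :- con 1ℤ :* (con (+ 2) :* s :* w :+ con 0ℤ :- (d :- s :* s))) refl d s w))
        (λ eq → lincomb (⊖ 1#) eq (solve 3 (λ d s w →
          con (+ 2) :* s :* w :+ con 0ℤ := d :- s :* s :+ :- con 1ℤ :* (w :* w :- ((con 1ℤ :* s :+ w) :* (con 1ℤ :* s :+ w) :- d))) refl d s w))))
      (∑-reindex w (λ y → δ (w ⊗ w) (y ⊗ y ⊝ d)) 1≢0)
    points : ∀ s → ∑ (λ w → δ (⟦ + 2 ⟧ ⊗ s ⊗ w ⊕ 0#) (d ⊝ s ⊗ s)) ≡ 1ℤ + δ s 0# * (+ q * δ d 0# - 1ℤ)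
    points s with s ≟ᶠ 0#
    ... | no s≢0   = ∑-linear 0# (d ⊝ s ⊗ s) (⊗-≢0 2≢0 s≢0)
    -- The line s = 0 is y = w, on which the equation reads 0 = d: all q points or none.
    ... | yes refl = begin
      ∑ (λ w → δ (⟦ + 2 ⟧ ⊗ 0# ⊗ w ⊕ 0#) (d ⊝ 0# ⊗ 0#))  ≡⟨ sum-cong-≗ (λ w → δ-cong
        (λ eq → trans (sym (d⊝0 d)) (trans (sym eq) (0w w))) (λ eq → trans (0w w) (trans (sym eq) (sym (d⊝0 d))))) ⟩
      ∑ (λ _ → δ d 0#)                                   ≡⟨ sum-const q (δ d 0#) ⟩
      + q * δ d 0#                                       ≡⟨ add-sub (+ q * δ d 0#) ⟩
      1ℤ + 1ℤ * (+ q * δ d 0# - 1ℤ)                      ∎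
      where
      add-sub : ∀ i → i ≡ 1ℤ + 1ℤ * (i - 1ℤ)
      add-sub = solve-∀
      d⊝0 : ∀ d → d ⊝ 0# ⊗ 0# ≡ d
      d⊝0 = solve 1 (λ d → d :- con 0ℤ :* con 0ℤ := d) refl
      0w : ∀ w → ⟦ + 2 ⟧ ⊗ 0# ⊗ w ⊕ 0# ≡ 0#
      0w = solve 1 (λ w → con (+ 2) :* con 0ℤ :* w :+ con 0ℤ := con 0ℤ) refl

  -- Each y carries 1 + χ (y² - d) points of the hyperbola, so the point count determines the sum.
  ∑χ-difference : ∀ d → ∑ (λ y → χ (y ⊗ y ⊝ d)) ≡ + q * δ d 0# - 1ℤ
  ∑χ-difference d = +-cancelˡ (+ q) (∑ (λ y → χ (y ⊗ y ⊝ d))) (+ q * δ d 0# - 1ℤ) (begin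
    + q + ∑ (λ y → χ (y ⊗ y ⊝ d))              ≡⟨ cong (_+ ∑ (λ y → χ (y ⊗ y ⊝ d))) (trans (sum-const q 1ℤ) (ℤₚ.*-identityʳ (+ q))) ⟨
    ∑ (λ _ → 1ℤ) + ∑ (λ y → χ (y ⊗ y ⊝ d))     ≡⟨ ∑-+ (λ _ → 1ℤ) (λ y → χ (y ⊗ y ⊝ d)) ⟨
    ∑ (λ y → 1ℤ + χ (y ⊗ y ⊝ d))               ≡⟨ sum-cong-≗ (λ y → ∑-square (y ⊗ y ⊝ d)) ⟨
    ∑ (λ y → ∑ (λ w → δ (w ⊗ w) (y ⊗ y ⊝ d)))  ≡⟨ ∑-swap (λ y w → δ (w ⊗ w) (y ⊗ y ⊝ d)) ⟩
    ∑ (λ w → ∑ (λ y → δ (w ⊗ w) (y ⊗ y ⊝ d)))  ≡⟨ ∑-hyperbola d ⟩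
    + q - 1ℤ + + q * δ d 0#                    ≡⟨ rearrange (+ q) (δ d 0#) ⟩
    + q + (+ q * δ d 0# - 1ℤ)                  ∎)
    where
    open ≡-Reasoning
    rearrange : ∀ i j → i - 1ℤ + i * j ≡ i + (i * j - 1ℤ)
    rearrange = solve-∀

  -- For a ≠ 0, multiplying by a² gives χ a times the character of (a y)² + a c. The two δ-terms
  -- account for the degenerate cases: c = 0, where the sum is (q - 1) χ a if a ≠ 0, and a = 0,
  -- where the summand is constant.
  ∑χ-conic : ∀ a c → ∑ (λ y → χ (a ⊗ (y ⊗ y) ⊕ c)) ≡ - χ a + + q * (δ c 0# * χ a) + + q * (δ a 0# * χ c)
  ∑χ-conic a c with a ≟ᶠ 0#
  ... | yes refl = begin
    ∑ (λ y → χ (0# ⊗ (y ⊗ y) ⊕ c))                         ≡⟨ sum-cong-≗ (λ y → cong χ (solve 2 (λ c y → con 0ℤ :* (y :* y) :+ c := c) refl c y)) ⟩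
    ∑ (λ _ → χ c)                                          ≡⟨ sum-const q (χ c) ⟩
    + q * χ c                                              ≡⟨ rearrange (+ q) (δ c 0#) (χ c) ⟩
    - 0ℤ + + q * (δ c 0# * 0ℤ) + + q * (1ℤ * χ c)          ≡⟨ cong (λ s → - s + + q * (δ c 0# * s) + + q * (1ℤ * χ c)) χ-zero ⟨
    - χ 0# + + q * (δ c 0# * χ 0#) + + q * (1ℤ * χ c)      ∎
    where
    open ≡-Reasoning
    rearrange : ∀ i j k → i * k ≡ - 0ℤ + i * (j * 0ℤ) + i * (1ℤ * k)
    rearrange = solve-∀
  ... | no a≢0 = begin
    ∑ (λ y → χ (a ⊗ (y ⊗ y) ⊕ c))                           ≡⟨ sum-cong-≗ term ⟩
    ∑ (λ y → χ a * χ (a ⊗ y ⊗ (a ⊗ y) ⊝ ⊖ (a ⊗ c)))         ≡⟨ ∑-* (χ a) (λ y → χ (a ⊗ y ⊗ (a ⊗ y) ⊝ ⊖ (a ⊗ c))) ⟩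
    χ a * ∑ (λ y → χ (a ⊗ y ⊗ (a ⊗ y) ⊝ ⊖ (a ⊗ c)))         ≡⟨ cong (λ s → χ a * s) (∑-scale (λ w → χ (w ⊗ w ⊝ ⊖ (a ⊗ c))) a≢0) ⟩
    χ a * ∑ (λ w → χ (w ⊗ w ⊝ ⊖ (a ⊗ c)))                   ≡⟨ cong (λ s → χ a * s) (∑χ-difference (⊖ (a ⊗ c))) ⟩
    χ a * (+ q * δ (⊖ (a ⊗ c)) 0# - 1ℤ)                     ≡⟨ cong (λ s → χ a * (+ q * s - 1ℤ)) (δ-cong -ac≡0⇒c≡0 (λ { refl → solve 1 (λ a → :- (a :* con 0ℤ) := con 0ℤ) refl a })) ⟩
    χ a * (+ q * δ c 0# - 1ℤ)                               ≡⟨ rearrange (+ q) (χ a) (δ c 0#) (χ c) ⟩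
    - χ a + + q * (δ c 0# * χ a) + + q * (0ℤ * χ c)         ∎
    where
    open ≡-Reasoning
    rearrange : ∀ i j k l → j * (i * k - 1ℤ) ≡ - j + i * (k * j) + i * (0ℤ * l)
    rearrange = solve-∀
    -ac≡0⇒c≡0 : ⊖ (a ⊗ c) ≡ 0# → c ≡ 0#
    -ac≡0⇒c≡0 eq = cancel a≢0 (lincomb (⊖ 1#) eq
      (solve 2 (λ a c → a :* c := a :* con 0ℤ :+ :- con 1ℤ :* (:- (a :* c) :- con 0ℤ)) refl a c))
    term : ∀ y → χ (a ⊗ (y ⊗ y) ⊕ c) ≡ χ a * χ (a ⊗ y ⊗ (a ⊗ y) ⊝ ⊖ (a ⊗ c))
    term y = trans (sym (χ-square-⊗ (a ⊗ (y ⊗ y) ⊕ c) a≢0)) (trans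
      (cong χ (solve 3 (λ a c y → a :* a :* (a :* (y :* y) :+ c) := a :* (a :* y :* (a :* y) :- (:- (a :* c)))) refl a c y))
      (χ-⊗ a (a ⊗ y ⊗ (a ⊗ y) ⊝ ⊖ (a ⊗ c))))

  -- Sums over triples

  ∑₃ : (Fin q → Fin q → Fin q → ℤ) → ℤ
  ∑₃ f = ∑ (λ x → ∑ (λ y → ∑ (λ z → f x y z)))

  ∑₃-cong : ∀ {f g : Fin q → Fin q → Fin q → ℤ} → (∀ x y z → f x y z ≡ g x y z) → ∑₃ f ≡ ∑₃ g
  ∑₃-cong f≗g = sum-cong-≗ (λ x → sum-cong-≗ (λ y → sum-cong-≗ (λ z → f≗g x y z)))

  ∑₃-+ : ∀ f g → ∑₃ (λ x y z → f x y z + g x y z) ≡ ∑₃ f + ∑₃ g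
  ∑₃-+ f g = trans
    (sum-cong-≗ (λ x → trans (sum-cong-≗ (λ y → ∑-+ (f x y) (g x y))) (∑-+ (λ y → ∑ (f x y)) (λ y → ∑ (g x y)))))
    (∑-+ (λ x → ∑ (λ y → ∑ (f x y))) (λ x → ∑ (λ y → ∑ (g x y))))

  ∑₃-* : ∀ c f → ∑₃ (λ x y z → c * f x y z) ≡ c * ∑₃ f
  ∑₃-* c f = trans
    (sum-cong-≗ (λ x → trans (sum-cong-≗ (λ y → ∑-* c (f x y))) (∑-* c (λ y → ∑ (f x y)))))
    (∑-* c (λ x → ∑ (λ y → ∑ (f x y))))

  ∑₃-rotate : ∀ f → ∑₃ (λ x y z → f y z x) ≡ ∑₃ f
  ∑₃-rotate f = trans
    (∑-swap (λ x y → ∑ (λ z → f y z x)))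
    (sum-cong-≗ (λ y → ∑-swap (λ x z → f y z x)))

  -- Cyclic symmetry: it suffices to count for one flip, or for one pair of flips.
  ∑₃-orbit : ∀ f {c} → ∑₃ f ≡ c → ∑₃ (λ x y z → f x y z + f y z x + f z x y) ≡ + 3 * c
  ∑₃-orbit f {c} eq = begin
    ∑₃ (λ x y z → f x y z + f y z x + f z x y)                     ≡⟨ ∑₃-+ (λ x y z → f x y z + f y z x) (λ x y z → f z x y) ⟩
    ∑₃ (λ x y z → f x y z + f y z x) + ∑₃ (λ x y z → f z x y)      ≡⟨ cong (_+ ∑₃ (λ x y z → f z x y)) (∑₃-+ f (λ x y z → f y z x)) ⟩
    ∑₃ f + ∑₃ (λ x y z → f y z x) + ∑₃ (λ x y z → f z x y)         ≡⟨ cong₂ (λ s t → ∑₃ f + s + t) (∑₃-rotate f) (sym (∑₃-rotate (λ x y z → f z x y))) ⟩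
    ∑₃ f + ∑₃ f + ∑₃ f                                             ≡⟨ cong (λ s → s + s + s) eq ⟩
    c + c + c                                                      ≡⟨ triple c ⟩
    + 3 * c                                                        ∎
    where
    open ≡-Reasoning
    triple : ∀ i → i + i + i ≡ + 3 * i
    triple = solve-∀

  ∑₃-δδ : ∀ (f : Fin q → ℤ) → ∑₃ (λ x y z → δ x 0# * (δ y 0# * f z)) ≡ ∑ f
  ∑₃-δδ f = trans
    (sum-cong-≗ (λ x → trans
      (sum-cong-≗ (λ y → trans (∑-* (δ x 0#) (λ z → δ y 0# * f z)) (cong (λ s → δ x 0# * s) (∑-* (δ y 0#) f))))
      (trans (∑-* (δ x 0#) (λ y → δ y 0# * ∑ f)) (cong (λ s → δ x 0# * s) (sum-δ 0# (λ _ → ∑ f))))))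
    (sum-δ 0# (λ _ → ∑ f))

  ∑-linear-combination : ∀ c₀ c₁ c₂ c₃ f g h →
    ∑ (λ x → c₀ + c₁ * f x + c₂ * g x + c₃ * h x) ≡ + q * c₀ + c₁ * ∑ f + c₂ * ∑ g + c₃ * ∑ h
  ∑-linear-combination c₀ c₁ c₂ c₃ f g h =
    trans (∑-+ (λ x → c₀ + c₁ * f x + c₂ * g x) (λ x → c₃ * h x)) (cong₂ _+_
    (trans (∑-+ (λ x → c₀ + c₁ * f x) (λ x → c₂ * g x)) (cong₂ _+_
    (trans (∑-+ (λ _ → c₀) (λ x → c₁ * f x)) (cong₂ _+_ (sum-const q c₀) (∑-* c₁ f)))
    (∑-* c₂ g))) (∑-* c₃ h))

  -- Solutions and the flips fixing them

  solution : Fin q → Fin q → Fin q → Fin q → ℤ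
  solution D x y z = δ (x ⊗ x ⊕ y ⊗ y ⊕ z ⊗ z) (x ⊗ y ⊗ z ⊕ D)

  solution-rotate : ∀ D x y z → solution D y z x ≡ solution D x y z
  solution-rotate D x y z = cong₂ δ
    (solve 3 (λ x y z → y :* y :+ z :* z :+ x :* x := x :* x :+ y :* y :+ z :* z) refl x y z)
    (solve 4 (λ D x y z → y :* z :* x :+ D := x :* y :* z :+ D) refl D x y z)

  -- The discriminant in z is regrouped as a quadratic in y without linear term, ready for
  -- `∑χ-conic`.
  ∑-solution-z : ∀ D x y → ∑ (solution D x y) ≡ 1ℤ + χ ((x ⊗ x ⊝ 4#) ⊗ (y ⊗ y) ⊕ ⊖ (4# ⊗ (x ⊗ x ⊝ D)))
  ∑-solution-z D x y = begin
    ∑ (solution D x y)                                                          ≡⟨ sum-cong-≗ (λ z → δ-cong (to z) (from z)) ⟩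
    ∑ (λ z → δ (z ⊗ z ⊕ (x ⊗ x ⊕ y ⊗ y ⊝ D)) (x ⊗ y ⊗ z))                       ≡⟨ ∑-quadratic (x ⊗ y) (x ⊗ x ⊕ y ⊗ y ⊝ D) ⟩
    1ℤ + χ (x ⊗ y ⊗ (x ⊗ y) ⊝ 4# ⊗ (x ⊗ x ⊕ y ⊗ y ⊝ D))                         ≡⟨ cong (λ d → 1ℤ + χ d) (solve 3 (λ D x y →
      x :* y :* (x :* y) :- con (+ 4) :* (x :* x :+ y :* y :- D) :=
      (x :* x :- con (+ 4)) :* (y :* y) :+ :- (con (+ 4) :* (x :* x :- D))) refl D x y) ⟩
    1ℤ + χ ((x ⊗ x ⊝ 4#) ⊗ (y ⊗ y) ⊕ ⊖ (4# ⊗ (x ⊗ x ⊝ D)))                      ∎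
    where
    open ≡-Reasoning
    to : ∀ z → x ⊗ x ⊕ y ⊗ y ⊕ z ⊗ z ≡ x ⊗ y ⊗ z ⊕ D → z ⊗ z ⊕ (x ⊗ x ⊕ y ⊗ y ⊝ D) ≡ x ⊗ y ⊗ z
    to z eq = lincomb 1# eq (solve 4 (λ D x y z → z :* z :+ (x :* x :+ y :* y :- D) := x :* y :* z :+ con 1ℤ :*
      (x :* x :+ y :* y :+ z :* z :- (x :* y :* z :+ D))) refl D x y z)
    from : ∀ z → z ⊗ z ⊕ (x ⊗ x ⊕ y ⊗ y ⊝ D) ≡ x ⊗ y ⊗ z → x ⊗ x ⊕ y ⊗ y ⊕ z ⊗ z ≡ x ⊗ y ⊗ z ⊕ D
    from z eq = lincomb 1# eq (solve 4 (λ D x y z → x :* x :+ y :* y :+ z :* z := x :* y :* z :+ D :+ con 1ℤ :*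
      (z :* z :+ (x :* x :+ y :* y :- D) :- x :* y :* z)) refl D x y z)

  -- The quadratic in y loses its constant term for x² = D and its leading term for x² = 4. The
  -- coefficient that survives is D - 4 in the first case and 4 (D - 4) in the second, so both
  -- contribute with χ (D - 4).
  ∑-solution-yz : ∀ D x → ∑ (λ y → ∑ (solution D x y)) ≡
    + q + -1ℤ * χ (x ⊗ x ⊝ 4#) + + q * χ (D ⊝ 4#) * δ (x ⊗ x) D + + q * χ (D ⊝ 4#) * δ (x ⊗ x) 4#
  ∑-solution-yz D x = begin
    ∑ (λ y → ∑ (solution D x y))                                      ≡⟨ sum-cong-≗ (∑-solution-z D x) ⟩
    ∑ (λ y → 1ℤ + χ (a ⊗ (y ⊗ y) ⊕ c))                                ≡⟨ ∑-+ (λ _ → 1ℤ) (λ y → χ (a ⊗ (y ⊗ y) ⊕ c)) ⟩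
    ∑ (λ _ → 1ℤ) + ∑ (λ y → χ (a ⊗ (y ⊗ y) ⊕ c))                      ≡⟨ cong₂ _+_ (sum-const q 1ℤ) (∑χ-conic a c) ⟩
    + q * 1ℤ + (- χ a + + q * (δ c 0# * χ a) + + q * (δ a 0# * χ c))  ≡⟨ cong₂ (λ s t → + q * 1ℤ + (- χ a + + q * s + + q * t)) c-term a-term ⟩
    + q * 1ℤ + (- χ a + + q * (δ (x ⊗ x) D * χ (D ⊝ 4#)) + + q * (δ (x ⊗ x) 4# * χ (D ⊝ 4#)))
                                                                      ≡⟨ rearrange (+ q) (χ a) (δ (x ⊗ x) D) (δ (x ⊗ x) 4#) (χ (D ⊝ 4#)) ⟩
    + q + -1ℤ * χ a + + q * χ (D ⊝ 4#) * δ (x ⊗ x) D + + q * χ (D ⊝ 4#) * δ (x ⊗ x) 4# ∎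
    where
    open ≡-Reasoning
    a c : Fin q
    a = x ⊗ x ⊝ 4#
    c = ⊖ (4# ⊗ (x ⊗ x ⊝ D))
    rearrange : ∀ i a j k l → i * 1ℤ + (- a + i * (j * l) + i * (k * l)) ≡ i + -1ℤ * a + i * l * j + i * l * k
    rearrange = solve-∀
    c≡0⇒x²≡D : c ≡ 0# → x ⊗ x ≡ D
    c≡0⇒x²≡D eq = cancel 4≢0 (lincomb (⊖ 1#) eq (solve 2 (λ D x →
      con (+ 4) :* (x :* x) := con (+ 4) :* D :+ :- con 1ℤ :* (:- (con (+ 4) :* (x :* x :- D)) :- con 0ℤ)) refl D x))
    x²≡D⇒c≡0 : x ⊗ x ≡ D → c ≡ 0#
    x²≡D⇒c≡0 eq = lincomb (⊖ 4#) eq (solve 2 (λ D x →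
      :- (con (+ 4) :* (x :* x :- D)) := con 0ℤ :+ :- con (+ 4) :* (x :* x :- D)) refl D x)
    x²≡4⇒a≡0 : x ⊗ x ≡ 4# → a ≡ 0#
    x²≡4⇒a≡0 eq = lincomb 1# eq (solve 1 (λ x → x :* x :- con (+ 4) := con 0ℤ :+ con 1ℤ :* (x :* x :- con (+ 4))) refl x)
    c-term : δ c 0# * χ a ≡ δ (x ⊗ x) D * χ (D ⊝ 4#)
    c-term = trans (𝟙-*-cong (c ≟ᶠ 0#) (λ c≡0 → cong (λ s → χ (s ⊝ 4#)) (c≡0⇒x²≡D c≡0)))
                   (cong (_* χ (D ⊝ 4#)) (δ-cong c≡0⇒x²≡D x²≡D⇒c≡0))
    a-term : δ a 0# * χ c ≡ δ (x ⊗ x) 4# * χ (D ⊝ 4#)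
    a-term = trans (𝟙-*-cong (a ≟ᶠ 0#) (λ a≡0 → trans
                     (cong χ (lincomb (⊖ 4#) a≡0 (solve 2 (λ D x → :- (con (+ 4) :* (x :* x :- D)) :=
                       con (+ 4) :* (D :- con (+ 4)) :+ :- con (+ 4) :* (x :* x :- con (+ 4) :- con 0ℤ)) refl D x)))
                     (χ-4⊗ (D ⊝ 4#))))
                   (cong (_* χ (D ⊝ 4#)) (δ-cong ⊝≡0⇒≡ x²≡4⇒a≡0))

  -- In 3 + χ D, the part 1 + χ D counts the roots of x² = D and 2 counts the roots of x² = 4. The
  -- summand 1 is the negative of the sum of χ (x² - 4).
  solution-count : ∀ D → ∑₃ (solution D) ≡ + q * + q + 1ℤ + (+ 3 + χ D) * χ (D ⊝ 4#) * + q
  solution-count D = begin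
    ∑₃ (solution D)
      ≡⟨ sum-cong-≗ (∑-solution-yz D) ⟩
    ∑ (λ x → + q + -1ℤ * χ (x ⊗ x ⊝ 4#) + + q * χ (D ⊝ 4#) * δ (x ⊗ x) D + + q * χ (D ⊝ 4#) * δ (x ⊗ x) 4#)
      ≡⟨ ∑-linear-combination (+ q) -1ℤ (+ q * χ (D ⊝ 4#)) (+ q * χ (D ⊝ 4#))
           (λ x → χ (x ⊗ x ⊝ 4#)) (λ x → δ (x ⊗ x) D) (λ x → δ (x ⊗ x) 4#) ⟩
    + q * + q + -1ℤ * ∑ (λ x → χ (x ⊗ x ⊝ 4#)) + + q * χ (D ⊝ 4#) * ∑ (λ x → δ (x ⊗ x) D)
      + + q * χ (D ⊝ 4#) * ∑ (λ x → δ (x ⊗ x) 4#)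
      ≡⟨ cong₂ (λ s t → + q * + q + -1ℤ * s + + q * χ (D ⊝ 4#) * ∑ (λ x → δ (x ⊗ x) D) + + q * χ (D ⊝ 4#) * t)
           (trans (∑χ-difference 4#) (cong (λ s → + q * s - 1ℤ) (δ-≢ 4≢0)))
           (trans (∑-square 4#) (cong (λ s → 1ℤ + s) χ4≡1)) ⟩
    + q * + q + -1ℤ * (+ q * 0ℤ - 1ℤ) + + q * χ (D ⊝ 4#) * ∑ (λ x → δ (x ⊗ x) D) + + q * χ (D ⊝ 4#) * + 2
      ≡⟨ cong (λ s → + q * + q + -1ℤ * (+ q * 0ℤ - 1ℤ) + + q * χ (D ⊝ 4#) * s + + q * χ (D ⊝ 4#) * + 2) (∑-square D) ⟩
    + q * + q + -1ℤ * (+ q * 0ℤ - 1ℤ) + + q * χ (D ⊝ 4#) * (1ℤ + χ D) + + q * χ (D ⊝ 4#) * + 2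
      ≡⟨ rearrange (+ q) (χ D) (χ (D ⊝ 4#)) ⟩
    + q * + q + 1ℤ + (+ 3 + χ D) * χ (D ⊝ 4#) * + q ∎
    where
    open ≡-Reasoning
    rearrange : ∀ i j k → i * i + -1ℤ * (i * 0ℤ - 1ℤ) + i * k * (1ℤ + j) + i * k * + 2 ≡ i * i + 1ℤ + (+ 3 + j) * k * i
    rearrange = solve-∀

  -- Indicates that the first flip fixes (x, y, z). The second and third flips are `fixed y z x` and
  -- `fixed z x y`.
  fixed : Fin q → Fin q → Fin q → ℤ
  fixed x y z = δ (y ⊗ z) (x ⊕ x)

  solution-indicates : ∀ D x y z → Indicates (x ⊗ x ⊕ y ⊗ y ⊕ z ⊗ z ≡ x ⊗ y ⊗ z ⊕ D) (solution D x y z)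
  solution-indicates D x y z = δ-indicates (x ⊗ x ⊕ y ⊗ y ⊕ z ⊗ z) (x ⊗ y ⊗ z ⊕ D)

  fixed-indicates : ∀ x y z → Indicates (y ⊗ z ≡ x ⊕ x) (fixed x y z)
  fixed-indicates x y z = δ-indicates (y ⊗ z) (x ⊕ x)

  -- The sum J(D) of the overview; t stands for the square of a coordinate.
  ∑χ-legendre : Fin q → ℤ
  ∑χ-legendre D = ∑ (λ t → χ (t ⊗ ((t ⊝ 4#) ⊗ (t ⊝ D))))

  module _ {D : Fin q} (D≢4 : D ≢ 4#) where

    4-D≢0 : 4# ⊝ D ≢ 0#
    4-D≢0 eq = D≢4 (sym (⊝≡0⇒≡ eq))

    -- Four times (t - 4)(t - D) is (2 t - (4 + D))² - (4 - D)², and D ≠ 4 keeps the subtracted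
    -- square nonzero.
    ∑χ-quadratic : ∑ (λ t → χ ((t ⊝ 4#) ⊗ (t ⊝ D))) ≡ -1ℤ
    ∑χ-quadratic = begin
      ∑ (λ t → χ ((t ⊝ 4#) ⊗ (t ⊝ D)))              ≡⟨ sum-cong-≗ (λ t → trans (sym (χ-4⊗ ((t ⊝ 4#) ⊗ (t ⊝ D)))) (cong χ (solve 2 (λ D t →
        con (+ 4) :* ((t :- con (+ 4)) :* (t :- D)) :=
        (con (+ 2) :* t :+ :- (con (+ 4) :+ D)) :* (con (+ 2) :* t :+ :- (con (+ 4) :+ D)) :- (con (+ 4) :- D) :* (con (+ 4) :- D)) refl D t))) ⟩
      ∑ (λ t → f (⟦ + 2 ⟧ ⊗ t ⊕ ⊖ (4# ⊕ D)))         ≡⟨ ∑-reindex (⊖ (4# ⊕ D)) f 2≢0 ⟩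
      ∑ f                                           ≡⟨ ∑χ-difference ((4# ⊝ D) ⊗ (4# ⊝ D)) ⟩
      + q * δ ((4# ⊝ D) ⊗ (4# ⊝ D)) 0# - 1ℤ         ≡⟨ cong (λ s → + q * s - 1ℤ) (δ-≢ (⊗-≢0 4-D≢0 4-D≢0)) ⟩
      + q * 0ℤ - 1ℤ                                 ≡⟨ cong (_- 1ℤ) (ℤₚ.*-zeroʳ (+ q)) ⟩
      -1ℤ                                           ∎
      where
      open ≡-Reasoning
      f : Fin q → ℤ
      f y = χ (y ⊗ y ⊝ (4# ⊝ D) ⊗ (4# ⊝ D))

    -- Substituting y z for 2 x in four times the equation eliminates x. The pair of conditions
    -- becomes one equation in y and z together with a linear equation for x, in the shape that
    -- `∑-linear` expects.
    solution×fixed : ∀ x y z → solution D x y z * fixed x y z ≡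
      δ ((y ⊗ y ⊝ 4#) ⊗ (z ⊗ z)) (4# ⊗ (y ⊗ y ⊝ D)) * δ (⟦ + 2 ⟧ ⊗ x ⊕ 0#) (y ⊗ z)
    solution×fixed x y z = indicates-unique lhs rhs
      (λ (sol , fix) →
        lincomb₂ (⊖ 4#) (y ⊗ z ⊝ (x ⊕ x)) sol fix (solve 4 (λ D x y z →
          (y :* y :- con (+ 4)) :* (z :* z) := con (+ 4) :* (y :* y :- D)
            :+ :- con (+ 4) :* (x :* x :+ y :* y :+ z :* z :- (x :* y :* z :+ D))
            :+ (y :* z :- (x :+ x)) :* (y :* z :- (x :+ x))) refl D x y z) ,
        trans (solve 1 (λ x → con (+ 2) :* x :+ con 0ℤ := x :+ x) refl x) (sym fix))
      (λ (quad , lin) →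
        cancel 4≢0 (lincomb₂ (⊖ 1#) (⟦ + 2 ⟧ ⊗ x ⊕ 0# ⊝ y ⊗ z) quad lin (solve 4 (λ D x y z →
          con (+ 4) :* (x :* x :+ y :* y :+ z :* z) := con (+ 4) :* (x :* y :* z :+ D)
            :+ :- con 1ℤ :* ((y :* y :- con (+ 4)) :* (z :* z) :- con (+ 4) :* (y :* y :- D))
            :+ (con (+ 2) :* x :+ con 0ℤ :- y :* z) :* (con (+ 2) :* x :+ con 0ℤ :- y :* z)) refl D x y z)) ,
        trans (sym lin) (solve 1 (λ x → con (+ 2) :* x :+ con 0ℤ := x :+ x) refl x))
      where
      lhs = solution-indicates D x y z ⟨*⟩ fixed-indicates x y z
      rhs = δ-indicates ((y ⊗ y ⊝ 4#) ⊗ (z ⊗ z)) (4# ⊗ (y ⊗ y ⊝ D)) ⟨*⟩ δ-indicates (⟦ + 2 ⟧ ⊗ x ⊕ 0#) (y ⊗ z)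

    -- For y² = 4 the equation reads 0 = 4 (4 - D) and has no root; the δ-term cancels the leading 1
    -- there. The final `0ℤ * 0ℤ` only pads to the shape of `∑-linear-combination`.
    ∑-fixed-z : ∀ y → ∑ (λ z → δ ((y ⊗ y ⊝ 4#) ⊗ (z ⊗ z)) (4# ⊗ (y ⊗ y ⊝ D))) ≡
      1ℤ + -1ℤ * δ (y ⊗ y) 4# + 1ℤ * χ ((y ⊗ y ⊝ 4#) ⊗ (y ⊗ y ⊝ D)) + 0ℤ * 0ℤ
    ∑-fixed-z y with y ⊗ y ≟ᶠ 4#
    ... | yes y²≡4 rewrite y²≡4 = trans
      (sum-cong-≗ (λ z → δ-≢ λ eq → ⊗-≢0 4≢0 4-D≢0 (trans (sym eq) (zero-⊗ (z ⊗ z)))))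
      (trans (sum-replicate-zero q) (cong (λ s → 0ℤ + 1ℤ * s + 0ℤ) (sym (χ-zero′ (zero-⊗ (4# ⊝ D))))))
      where
      zero-⊗ : ∀ x → (4# ⊝ 4#) ⊗ x ≡ 0#
      zero-⊗ = solve 1 (λ x → (con (+ 4) :- con (+ 4)) :* x := con 0ℤ) refl
    ... | no y²≢4 = trans (∑-scaled-square (4# ⊗ (y ⊗ y ⊝ D)) (y²≢4 ∘ ⊝≡0⇒≡)) (trans
      (cong (λ s → 1ℤ + s) (trans
        (cong χ (solve 2 (λ a b → a :* (con (+ 4) :* b) := con (+ 4) :* (a :* b)) refl (y ⊗ y ⊝ 4#) (y ⊗ y ⊝ D)))
        (χ-4⊗ ((y ⊗ y ⊝ 4#) ⊗ (y ⊗ y ⊝ D)))))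
      (rearrange (χ ((y ⊗ y ⊝ 4#) ⊗ (y ⊗ y ⊝ D)))))
      where
      rearrange : ∀ i → 1ℤ + i ≡ 1ℤ + -1ℤ * 0ℤ + 1ℤ * i + 0ℤ * 0ℤ
      rearrange = solve-∀

    -- The count over z depends on y only through t = y², and t has weight 1 + χ t. The unweighted
    -- part is `∑χ-quadratic`, the part weighted by χ t is `∑χ-legendre`. In the constant, -2 comes
    -- from the two roots of y² = 4 and -1 from `∑χ-quadratic`.
    fixed-count : ∑₃ (λ x y z → solution D x y z * fixed x y z) ≡ + q - + 3 + ∑χ-legendre D
    fixed-count = begin
      ∑₃ (λ x y z → solution D x y z * fixed x y z)
        ≡⟨ ∑₃-rotate (λ y z x → solution D x y z * fixed x y z) ⟩
      ∑₃ (λ y z x → solution D x y z * fixed x y z)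
        ≡⟨ ∑₃-cong (λ y z x → solution×fixed x y z) ⟩
      ∑₃ (λ y z x → quad y z * δ (⟦ + 2 ⟧ ⊗ x ⊕ 0#) (y ⊗ z))
        ≡⟨ sum-cong-≗ (λ y → sum-cong-≗ (λ z → trans (∑-* (quad y z) (λ x → δ (⟦ + 2 ⟧ ⊗ x ⊕ 0#) (y ⊗ z)))
             (trans (cong (λ s → quad y z * s) (∑-linear 0# (y ⊗ z) 2≢0)) (ℤₚ.*-identityʳ (quad y z))))) ⟩
      ∑ (λ y → ∑ (quad y))
        ≡⟨ sum-cong-≗ ∑-fixed-z ⟩
      ∑ (λ y → 1ℤ + -1ℤ * δ (y ⊗ y) 4# + 1ℤ * f (y ⊗ y) + 0ℤ * 0ℤ)
        ≡⟨ ∑-linear-combination 1ℤ -1ℤ 1ℤ 0ℤ (λ y → δ (y ⊗ y) 4#) (λ y → f (y ⊗ y)) (λ _ → 0ℤ) ⟩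
      + q * 1ℤ + -1ℤ * ∑ (λ y → δ (y ⊗ y) 4#) + 1ℤ * ∑ (λ y → f (y ⊗ y)) + 0ℤ * ∑ (λ _ → 0ℤ)
        ≡⟨ cong₂ (λ s t → + q * 1ℤ + -1ℤ * s + 1ℤ * t + 0ℤ * ∑ (λ _ → 0ℤ))
             (trans (∑-square 4#) (cong (λ s → 1ℤ + s) χ4≡1))
             (trans (∑-pullback-square f) (cong₂ _+_ ∑χ-quadratic (sum-cong-≗ λ t → sym (χ-⊗ t ((t ⊝ 4#) ⊗ (t ⊝ D)))))) ⟩
      + q * 1ℤ + -1ℤ * + 2 + 1ℤ * (-1ℤ + ∑χ-legendre D) + 0ℤ * ∑ (λ _ → 0ℤ)
        ≡⟨ rearrange (+ q) (∑χ-legendre D) (∑ (λ _ → 0ℤ)) ⟩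
      + q - + 3 + ∑χ-legendre D ∎
      where
      open ≡-Reasoning
      quad : Fin q → Fin q → ℤ
      quad y z = δ ((y ⊗ y ⊝ 4#) ⊗ (z ⊗ z)) (4# ⊗ (y ⊗ y ⊝ D))
      f : Fin q → ℤ
      f t = χ ((t ⊝ 4#) ⊗ (t ⊝ D))
      rearrange : ∀ i j k → i * 1ℤ + -1ℤ * + 2 + 1ℤ * (-1ℤ + j) + 0ℤ * k ≡ i - + 3 + j
      rearrange = solve-∀

    -- From y z = 2 x and z x = 2 y follow x z² = 4 x and x² z² = 4 y². If x ≠ 0, then z² = 4 and y²
    -- = x², and the equation collapses to 2 x² + 4 = 2 x² + D, against D ≠ 4.
    fixed₂⇒axis : ∀ {x y z} → x ⊗ x ⊕ y ⊗ y ⊕ z ⊗ z ≡ x ⊗ y ⊗ z ⊕ D → y ⊗ z ≡ x ⊕ x → z ⊗ x ≡ y ⊕ y →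
      x ≡ 0# × y ≡ 0# × z ⊗ z ≡ D
    fixed₂⇒axis {x} {y} {z} sol fix-x fix-y = x≡0 , y≡0 , z²≡D
      where
      x≢0⇒D≡4 : x ≢ 0# → D ≡ 4#
      x≢0⇒D≡4 x≢0 = lincomb (⊖ 1#) (trans (sym left) (trans sol right)) (solve 2 (λ D x →
        D := con (+ 4) :+ :- con 1ℤ :* (x :* x :+ x :* x :+ con (+ 4) :- (x :* (x :+ x) :+ D))) refl D x)
        where
        z²≡4 : z ⊗ z ≡ 4#
        z²≡4 = cancel x≢0 (lincomb₂ ⟦ + 2 ⟧ z fix-x fix-y (solve 3 (λ x y z →
          x :* (z :* z) := x :* con (+ 4) :+ con (+ 2) :* (y :* z :- (x :+ x)) :+ z :* (z :* x :- (y :+ y))) refl x y z))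
        y²≡x² : y ⊗ y ≡ x ⊗ x
        y²≡x² = cancel 4≢0 (lincomb₂ (⊖ (z ⊗ x ⊕ (y ⊕ y))) (x ⊗ x) fix-y z²≡4 (solve 3 (λ x y z →
          con (+ 4) :* (y :* y) := con (+ 4) :* (x :* x) :+ :- (z :* x :+ (y :+ y)) :* (z :* x :- (y :+ y))
            :+ x :* x :* (z :* z :- con (+ 4))) refl x y z))
        left : x ⊗ x ⊕ y ⊗ y ⊕ z ⊗ z ≡ x ⊗ x ⊕ x ⊗ x ⊕ 4#
        left = cong₂ (λ s t → x ⊗ x ⊕ s ⊕ t) y²≡x² z²≡4
        right : x ⊗ y ⊗ z ⊕ D ≡ x ⊗ (x ⊕ x) ⊕ D
        right = trans (solve 4 (λ D x y z → x :* y :* z :+ D := x :* (y :* z) :+ D) refl D x y z)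
                      (cong (λ s → x ⊗ s ⊕ D) fix-x)
      x≡0 : x ≡ 0#
      x≡0 = decidable-stable (x ≟ᶠ 0#) (λ x≢0 → D≢4 (x≢0⇒D≡4 x≢0))
      y≡0 : y ≡ 0#
      y≡0 = cancel 2≢0 (lincomb₂ z (⊖ 1#) x≡0 fix-y (solve 3 (λ x y z →
        con (+ 2) :* y := con (+ 2) :* con 0ℤ :+ z :* (x :- con 0ℤ) :+ :- con 1ℤ :* (z :* x :- (y :+ y))) refl x y z))
      z²≡D : z ⊗ z ≡ D
      z²≡D = trans (solve 1 (λ z → z :* z := con 0ℤ :* con 0ℤ :+ con 0ℤ :* con 0ℤ :+ z :* z) refl z)
        (trans (subst (λ (x , y) → x ⊗ x ⊕ y ⊗ y ⊕ z ⊗ z ≡ x ⊗ y ⊗ z ⊕ D) (cong₂ _,_ x≡0 y≡0) sol)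
        (solve 2 (λ D z → con 0ℤ :* con 0ℤ :* z :+ D := D) refl D z))

    fixed₂-count : ∑₃ (λ x y z → solution D x y z * (fixed x y z * fixed y z x)) ≡ 1ℤ + χ D
    fixed₂-count = begin
      ∑₃ (λ x y z → solution D x y z * (fixed x y z * fixed y z x))  ≡⟨ ∑₃-cong pointwise ⟩
      ∑₃ (λ x y z → δ x 0# * (δ y 0# * δ (z ⊗ z) D))                 ≡⟨ ∑₃-δδ (λ z → δ (z ⊗ z) D) ⟩
      ∑ (λ z → δ (z ⊗ z) D)                                          ≡⟨ ∑-square D ⟩
      1ℤ + χ D                                                       ∎
      where
      open ≡-Reasoning
      pointwise : ∀ x y z → solution D x y z * (fixed x y z * fixed y z x) ≡ δ x 0# * (δ y 0# * δ (z ⊗ z) D)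
      pointwise x y z = indicates-unique lhs rhs
        (λ (sol , fix-x , fix-y) → fixed₂⇒axis sol fix-x fix-y)
        (λ { (refl , refl , refl) →
          solve 1 (λ z → con 0ℤ :* con 0ℤ :+ con 0ℤ :* con 0ℤ :+ z :* z := con 0ℤ :* con 0ℤ :* z :+ z :* z) refl z ,
          solve 1 (λ z → con 0ℤ :* z := con 0ℤ :+ con 0ℤ) refl z ,
          solve 1 (λ z → z :* con 0ℤ := con 0ℤ :+ con 0ℤ) refl z })
        where
        lhs = solution-indicates D x y z ⟨*⟩ fixed-indicates x y z ⟨*⟩ fixed-indicates y z x
        rhs = δ-indicates x 0# ⟨*⟩ δ-indicates y 0# ⟨*⟩ δ-indicates (z ⊗ z) D

    fixed₃⇒origin : ∀ {x y z} → x ⊗ x ⊕ y ⊗ y ⊕ z ⊗ z ≡ x ⊗ y ⊗ z ⊕ D →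
      y ⊗ z ≡ x ⊕ x → z ⊗ x ≡ y ⊕ y → x ⊗ y ≡ z ⊕ z → x ≡ 0# × y ≡ 0# × z ≡ 0# × D ≡ 0#
    fixed₃⇒origin {x} {y} {z} sol fix-x fix-y fix-z =
      proj₁ axis , proj₁ (proj₂ axis) , z≡0 ,
      trans (sym (proj₂ (proj₂ axis))) (trans (cong (λ s → s ⊗ s) z≡0) (⊗-zeroʳ 0#))
      where
      axis : x ≡ 0# × y ≡ 0# × z ⊗ z ≡ D
      axis = fixed₂⇒axis sol fix-x fix-y
      z≡0 : z ≡ 0#
      z≡0 = cancel 2≢0 (lincomb₂ y (⊖ 1#) (proj₁ axis) fix-z (solve 3 (λ x y z →
        con (+ 2) :* z := con (+ 2) :* con 0ℤ :+ y :* (x :- con 0ℤ) :+ :- con 1ℤ :* (x :* y :- (z :+ z))) refl x y z))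

    fixed₃-count : ∑₃ (λ x y z → solution D x y z * (fixed x y z * (fixed y z x * fixed z x y))) ≡ δ D 0#
    fixed₃-count = begin
      ∑₃ (λ x y z → solution D x y z * (fixed x y z * (fixed y z x * fixed z x y)))
        ≡⟨ ∑₃-cong pointwise ⟩
      ∑₃ (λ x y z → δ x 0# * (δ y 0# * (δ z 0# * δ D 0#)))
        ≡⟨ ∑₃-δδ (λ z → δ z 0# * δ D 0#) ⟩
      ∑ (λ z → δ z 0# * δ D 0#)
        ≡⟨ sum-δ 0# (λ _ → δ D 0#) ⟩
      δ D 0# ∎
      where
      open ≡-Reasoning
      pointwise : ∀ x y z → solution D x y z * (fixed x y z * (fixed y z x * fixed z x y)) ≡
        δ x 0# * (δ y 0# * (δ z 0# * δ D 0#))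
      pointwise x y z = indicates-unique lhs rhs
        (λ (sol , fix-x , fix-y , fix-z) → fixed₃⇒origin sol fix-x fix-y fix-z)
        (λ { (refl , refl , refl , refl) →
            solve 0 (con 0ℤ :* con 0ℤ :+ con 0ℤ :* con 0ℤ :+ con 0ℤ :* con 0ℤ := con 0ℤ :* con 0ℤ :* con 0ℤ :+ con 0ℤ) refl ,
            0²≡0+0 , 0²≡0+0 , 0²≡0+0 })
        where
        0²≡0+0 : 0# ⊗ 0# ≡ 0# ⊕ 0#
        0²≡0+0 = solve 0 (con 0ℤ :* con 0ℤ := con 0ℤ :+ con 0ℤ) refl
        lhs = solution-indicates D x y z ⟨*⟩ fixed-indicates x y z ⟨*⟩ fixed-indicates y z x ⟨*⟩ fixed-indicates z x y
        rhs = δ-indicates x 0# ⟨*⟩ δ-indicates y 0# ⟨*⟩ δ-indicates z 0# ⟨*⟩ δ-indicates D 0#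

    symmetric-count : ∀ c₁ c₂ c₃ →
      ∑₃ (λ x y z → solution D x y z * symmetric c₁ c₂ c₃ (fixed x y z) (fixed y z x) (fixed z x y))
      ≡ c₁ * (+ 3 * (+ q - + 3 + ∑χ-legendre D)) + c₂ * (+ 3 * (1ℤ + χ D)) + c₃ * δ D 0#
    symmetric-count c₁ c₂ c₃ = begin
      ∑₃ (λ x y z → solution D x y z * symmetric c₁ c₂ c₃ (fixed x y z) (fixed y z x) (fixed z x y))
        ≡⟨ ∑₃-cong (λ x y z → trans
             (rearrange c₁ c₂ c₃ (solution D x y z) (fixed x y z) (fixed y z x) (fixed z x y))
             -- The solution indicator is invariant under rotation; rotating it along with each flip
             -- turns the terms into rotations of `T₁` and `T₂`.
             (cong₂ (λ s s′ → c₁ * (solution D x y z * fixed x y z + s * fixed y z x + s′ * fixed z x y)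
               + c₂ * (solution D x y z * (fixed x y z * fixed y z x) + s * (fixed y z x * fixed z x y) + s′ * (fixed z x y * fixed x y z))
               + c₃ * (solution D x y z * (fixed x y z * (fixed y z x * fixed z x y))))
               (sym (solution-rotate D x y z)) (solution-rotate D z x y))) ⟩
      ∑₃ (λ x y z → c₁ * (T₁ x y z + T₁ y z x + T₁ z x y) + c₂ * (T₂ x y z + T₂ y z x + T₂ z x y) + c₃ * T₃ x y z)
        ≡⟨ ∑₃-+ (λ x y z → c₁ * (T₁ x y z + T₁ y z x + T₁ z x y) + c₂ * (T₂ x y z + T₂ y z x + T₂ z x y)) (λ x y z → c₃ * T₃ x y z) ⟩
      ∑₃ (λ x y z → c₁ * (T₁ x y z + T₁ y z x + T₁ z x y) + c₂ * (T₂ x y z + T₂ y z x + T₂ z x y)) + ∑₃ (λ x y z → c₃ * T₃ x y z)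
        ≡⟨ cong₂ _+_
             (trans (∑₃-+ (λ x y z → c₁ * (T₁ x y z + T₁ y z x + T₁ z x y)) (λ x y z → c₂ * (T₂ x y z + T₂ y z x + T₂ z x y)))
               (cong₂ _+_ (trans (∑₃-* c₁ (λ x y z → T₁ x y z + T₁ y z x + T₁ z x y)) (cong (λ s → c₁ * s) (∑₃-orbit T₁ fixed-count)))
                          (trans (∑₃-* c₂ (λ x y z → T₂ x y z + T₂ y z x + T₂ z x y)) (cong (λ s → c₂ * s) (∑₃-orbit T₂ fixed₂-count)))))
             (trans (∑₃-* c₃ T₃) (cong (λ s → c₃ * s) fixed₃-count)) ⟩
      c₁ * (+ 3 * (+ q - + 3 + ∑χ-legendre D)) + c₂ * (+ 3 * (1ℤ + χ D)) + c₃ * δ D 0# ∎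
      where
      open ≡-Reasoning
      T₁ T₂ T₃ : Fin q → Fin q → Fin q → ℤ
      T₁ x y z = solution D x y z * fixed x y z
      T₂ x y z = solution D x y z * (fixed x y z * fixed y z x)
      T₃ x y z = solution D x y z * (fixed x y z * (fixed y z x * fixed z x y))
      rearrange : ∀ c₁ c₂ c₃ s f g h →
        s * (c₁ * (f + g + h) + c₂ * (f * g + g * h + h * f) + c₃ * (f * (g * h))) ≡
        c₁ * (s * f + s * g + s * h) + c₂ * (s * (f * g) + s * (g * h) + s * (h * f)) + c₃ * (s * (f * (g * h)))
      rearrange = solve-∀

  -- The Jacobsthal sum

  curve-sum : Fin q → ℤ
  curve-sum a = ∑ (λ u → χ (u ⊗ u ⊗ u ⊝ a ⊗ u))

  -- Substituting u = c s extracts the factor c³, and χ (c³) = χ c.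
  curve-sum-twist : ∀ c a → c ≢ 0# → curve-sum (c ⊗ c ⊗ a) ≡ χ c * curve-sum a
  curve-sum-twist c a c≢0 = begin
    curve-sum (c ⊗ c ⊗ a)                        ≡⟨ ∑-scale f c≢0 ⟨
    ∑ (λ s → f (c ⊗ s))                          ≡⟨ sum-cong-≗ term ⟩
    ∑ (λ s → χ c * χ (s ⊗ s ⊗ s ⊝ a ⊗ s))        ≡⟨ ∑-* (χ c) (λ s → χ (s ⊗ s ⊗ s ⊝ a ⊗ s)) ⟩
    χ c * curve-sum a                            ∎
    where
    open ≡-Reasoning
    f : Fin q → ℤ
    f u = χ (u ⊗ u ⊗ u ⊝ c ⊗ c ⊗ a ⊗ u)
    term : ∀ s → f (c ⊗ s) ≡ χ c * χ (s ⊗ s ⊗ s ⊝ a ⊗ s)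
    term s = trans (cong χ (solve 3 (λ a c s →
        c :* s :* (c :* s) :* (c :* s) :- c :* c :* a :* (c :* s) := c :* c :* (c :* (s :* s :* s :- a :* s))) refl a c s))
      (trans (χ-square-⊗ (c ⊗ (s ⊗ s ⊗ s ⊝ a ⊗ s)) c≢0) (χ-⊗ c (s ⊗ s ⊗ s ⊝ a ⊗ s)))

  jacobsthal : ℤ
  jacobsthal = ∑ (λ x → χ (x ⊗ x ⊗ x ⊕ x))

  -- The 2-isogeny (x, y) ↦ (x + 1/x, …) from y² = x³ + x to v² = u³ - 4u: χ (x³ + x) = χ (x + 1/x),
  -- and u = x + 1/x has 1 + χ (u² - 4) solutions x.
  jacobsthal-isogeny : jacobsthal ≡ curve-sum 4#
  jacobsthal-isogeny = begin
    jacobsthal                                                ≡⟨ sum-cong-≗ fibre-x ⟨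
    ∑ (λ x → ∑ (λ u → δ (x ⊗ x ⊕ 1#) (u ⊗ x) * χ u))          ≡⟨ ∑-swap (λ x u → δ (x ⊗ x ⊕ 1#) (u ⊗ x) * χ u) ⟩
    ∑ (λ u → ∑ (λ x → δ (x ⊗ x ⊕ 1#) (u ⊗ x) * χ u))          ≡⟨ sum-cong-≗ fibre-u ⟩
    ∑ (λ u → χ u + χ (u ⊗ u ⊗ u ⊝ 4# ⊗ u))                    ≡⟨ ∑-+ χ (λ u → χ (u ⊗ u ⊗ u ⊝ 4# ⊗ u)) ⟩
    ∑ χ + curve-sum 4#                                        ≡⟨ cong (_+ curve-sum 4#) ∑χ≡0 ⟩
    0ℤ + curve-sum 4#                                         ≡⟨ ℤₚ.+-identityˡ (curve-sum 4#) ⟩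
    curve-sum 4#                                              ∎
    where
    open ≡-Reasoning
    -- A nonzero x determines u, and x² u = x³ + x gives χ u = χ (x³ + x). At x = 0 there is no u,
    -- in agreement with χ 0 = 0.
    fibre-x : ∀ x → ∑ (λ u → δ (x ⊗ x ⊕ 1#) (u ⊗ x) * χ u) ≡ χ (x ⊗ x ⊗ x ⊕ x)
    fibre-x x with x ≟ᶠ 0#
    ... | yes refl = trans
      (sum-cong-≗ (λ u → cong (_* χ u) (δ-≢ λ eq → 1≢0 (lincomb 1# eq (solve 1 (λ u →
        con 1ℤ := con 0ℤ :+ con 1ℤ :* (con 0ℤ :* con 0ℤ :+ con 1ℤ :- u :* con 0ℤ)) refl u)))))
      (trans (sum-replicate-zero q) (sym (χ-zero′ (solve 0 (con 0ℤ :* con 0ℤ :* con 0ℤ :+ con 0ℤ := con 0ℤ) refl))))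
    ... | no x≢0 = begin
      ∑ (λ u → δ (x ⊗ x ⊕ 1#) (u ⊗ x) * χ u)                  ≡⟨ sum-cong-≗ (λ u → 𝟙-*-cong (x ⊗ x ⊕ 1# ≟ᶠ u ⊗ x) (χu u)) ⟩
      ∑ (λ u → δ (x ⊗ x ⊕ 1#) (u ⊗ x) * χ (x ⊗ x ⊗ x ⊕ x))    ≡⟨ sum-cong-≗ (λ u → trans (ℤₚ.*-comm (δ (x ⊗ x ⊕ 1#) (u ⊗ x)) (χ (x ⊗ x ⊗ x ⊕ x)))
        (cong (λ s → χ (x ⊗ x ⊗ x ⊕ x) * s) (δ-cong (λ eq → trans (ux u) (sym eq)) (λ eq → trans (sym eq) (ux u))))) ⟩
      ∑ (λ u → χ (x ⊗ x ⊗ x ⊕ x) * δ (x ⊗ u ⊕ 0#) (x ⊗ x ⊕ 1#))  ≡⟨ ∑-* (χ (x ⊗ x ⊗ x ⊕ x)) (λ u → δ (x ⊗ u ⊕ 0#) (x ⊗ x ⊕ 1#)) ⟩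
      χ (x ⊗ x ⊗ x ⊕ x) * ∑ (λ u → δ (x ⊗ u ⊕ 0#) (x ⊗ x ⊕ 1#))  ≡⟨ cong (λ s → χ (x ⊗ x ⊗ x ⊕ x) * s) (∑-linear 0# (x ⊗ x ⊕ 1#) x≢0) ⟩
      χ (x ⊗ x ⊗ x ⊕ x) * 1ℤ                                  ≡⟨ ℤₚ.*-identityʳ (χ (x ⊗ x ⊗ x ⊕ x)) ⟩
      χ (x ⊗ x ⊗ x ⊕ x)                                       ∎
      where
      ux : ∀ u → x ⊗ u ⊕ 0# ≡ u ⊗ x
      ux u = solve 2 (λ x u → x :* u :+ con 0ℤ := u :* x) refl x u
      χu : ∀ u → x ⊗ x ⊕ 1# ≡ u ⊗ x → χ u ≡ χ (x ⊗ x ⊗ x ⊕ x)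
      χu u eq = trans (sym (χ-square-⊗ u x≢0)) (cong χ (lincomb (⊖ x) eq (solve 2 (λ x u →
        x :* x :* u := x :* x :* x :+ x :+ :- x :* (x :* x :+ con 1ℤ :- u :* x)) refl x u)))
    fibre-u : ∀ u → ∑ (λ x → δ (x ⊗ x ⊕ 1#) (u ⊗ x) * χ u) ≡ χ u + χ (u ⊗ u ⊗ u ⊝ 4# ⊗ u)
    fibre-u u = begin
      ∑ (λ x → δ (x ⊗ x ⊕ 1#) (u ⊗ x) * χ u)    ≡⟨ sum-cong-≗ (λ x → ℤₚ.*-comm (δ (x ⊗ x ⊕ 1#) (u ⊗ x)) (χ u)) ⟩
      ∑ (λ x → χ u * δ (x ⊗ x ⊕ 1#) (u ⊗ x))    ≡⟨ ∑-* (χ u) (λ x → δ (x ⊗ x ⊕ 1#) (u ⊗ x)) ⟩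
      χ u * ∑ (λ x → δ (x ⊗ x ⊕ 1#) (u ⊗ x))    ≡⟨ cong (λ s → χ u * s) (∑-quadratic u 1#) ⟩
      χ u * (1ℤ + χ (u ⊗ u ⊝ 4# ⊗ 1#))          ≡⟨ distrib (χ u) (χ (u ⊗ u ⊝ 4# ⊗ 1#)) ⟩
      χ u + χ u * χ (u ⊗ u ⊝ 4# ⊗ 1#)           ≡⟨ cong (λ s → χ u + s) (trans (sym (χ-⊗ u (u ⊗ u ⊝ 4# ⊗ 1#)))
        (cong χ (solve 1 (λ u → u :* (u :* u :- con (+ 4) :* con 1ℤ) := u :* u :* u :- con (+ 4) :* u) refl u))) ⟩
      χ u + χ (u ⊗ u ⊗ u ⊝ 4# ⊗ u)              ∎
      where
      distrib : ∀ i j → i * (1ℤ + j) ≡ i + i * j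
      distrib = solve-∀

  -- Evaluation of the cubic sums at D = 0, -4, 2, 8

  -1≢0 : ⟦ -1ℤ ⟧ ≢ 0#
  -1≢0 eq = 1≢0 (lincomb (⊖ 1#) eq (solve 0 (con 1ℤ := con 0ℤ :+ :- con 1ℤ :* (con -1ℤ :- con 0ℤ)) refl))

  curve-sum-16 : curve-sum ⟦ + 16 ⟧ ≡ χ ⟦ + 2 ⟧ * jacobsthal
  curve-sum-16 = trans
    (cong curve-sum (solve 0 (con (+ 16) := con (+ 2) :* con (+ 2) :* con (+ 4)) refl))
    (trans (curve-sum-twist ⟦ + 2 ⟧ 4# 2≢0) (cong (λ s → χ ⟦ + 2 ⟧ * s) (sym jacobsthal-isogeny)))

  -- Twisting by -1 fixes the curve because (-1)² = 1. This is what turns the sign χ 2 found for D =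
  -- -4 into χ (-2).
  jacobsthal-neg : jacobsthal ≡ χ ⟦ -1ℤ ⟧ * jacobsthal
  jacobsthal-neg = trans jacobsthal-isogeny (trans
    (cong curve-sum (solve 0 (con (+ 4) := con -1ℤ :* con -1ℤ :* con (+ 4)) refl))
    (trans (curve-sum-twist ⟦ -1ℤ ⟧ 4# -1≢0) (cong (λ s → χ ⟦ -1ℤ ⟧ * s) (sym jacobsthal-isogeny))))

  χ-neg2 : χ ⟦ - + 2 ⟧ ≡ χ ⟦ + 2 ⟧ * χ ⟦ -1ℤ ⟧
  χ-neg2 = trans (cong χ (⟦⟧-* (+ 2) -1ℤ)) (χ-⊗ ⟦ + 2 ⟧ ⟦ -1ℤ ⟧)

  -- For t ≠ 0 the double factor t² drops out and leaves χ (t - 4), whose sum over all t is 0. The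
  -- correction at t = 0 removes χ (-4) = χ (-1).
  legendre-0 : ∑χ-legendre 0# ≡ - χ ⟦ -1ℤ ⟧
  legendre-0 = begin
    ∑χ-legendre 0#                                                  ≡⟨ sum-cong-≗ term ⟩
    ∑ (λ t → χ (1# ⊗ t ⊕ ⊖ 4#) + δ t 0# * - χ ⟦ -1ℤ ⟧)              ≡⟨ ∑-+ (λ t → χ (1# ⊗ t ⊕ ⊖ 4#)) (λ t → δ t 0# * - χ ⟦ -1ℤ ⟧) ⟩
    ∑ (λ t → χ (1# ⊗ t ⊕ ⊖ 4#)) + ∑ (λ t → δ t 0# * - χ ⟦ -1ℤ ⟧)    ≡⟨ cong₂ _+_ (trans (∑-reindex (⊖ 4#) χ 1≢0) ∑χ≡0) (sum-δ 0# (λ _ → - χ ⟦ -1ℤ ⟧)) ⟩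
    0ℤ + - χ ⟦ -1ℤ ⟧                                                ≡⟨ ℤₚ.+-identityˡ (- χ ⟦ -1ℤ ⟧) ⟩
    - χ ⟦ -1ℤ ⟧                                                     ∎
    where
    open ≡-Reasoning
    term : ∀ t → χ (t ⊗ ((t ⊝ 4#) ⊗ (t ⊝ 0#))) ≡ χ (1# ⊗ t ⊕ ⊖ 4#) + δ t 0# * - χ ⟦ -1ℤ ⟧
    term t with t ≟ᶠ 0#
    ... | yes refl = trans (χ-zero′ (⊗-zeroˡ ((0# ⊝ 4#) ⊗ (0# ⊝ 0#)))) (sym (trans
      (cong (_+ 1ℤ * - χ ⟦ -1ℤ ⟧) (trans
        (cong χ (solve 0 (con 1ℤ :* con 0ℤ :+ :- con (+ 4) := con (+ 4) :* con -1ℤ) refl))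
        (χ-4⊗ ⟦ -1ℤ ⟧)))
      (sub-self (χ ⟦ -1ℤ ⟧))))
      where
      sub-self : ∀ i → i + 1ℤ * - i ≡ 0ℤ
      sub-self = solve-∀
    ... | no t≢0 = trans
      (cong χ (solve 1 (λ t → t :* ((t :- con (+ 4)) :* (t :- con 0ℤ)) := t :* t :* (con 1ℤ :* t :+ :- con (+ 4))) refl t))
      (trans (χ-square-⊗ (1# ⊗ t ⊕ ⊖ 4#) t≢0) (sym (ℤₚ.+-identityʳ (χ (1# ⊗ t ⊕ ⊖ 4#)))))

  legendre-neg4 : ∑χ-legendre ⟦ - + 4 ⟧ ≡ χ ⟦ - + 2 ⟧ * jacobsthal
  legendre-neg4 = begin
    ∑χ-legendre ⟦ - + 4 ⟧                         ≡⟨ sum-cong-≗ (λ t → cong χ (solve 1 (λ t →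
      t :* ((t :- con (+ 4)) :* (t :- con (- + 4))) := t :* t :* t :- con (+ 16) :* t) refl t)) ⟩
    curve-sum ⟦ + 16 ⟧                            ≡⟨ curve-sum-16 ⟩
    χ ⟦ + 2 ⟧ * jacobsthal                        ≡⟨ cong (λ s → χ ⟦ + 2 ⟧ * s) jacobsthal-neg ⟩
    χ ⟦ + 2 ⟧ * (χ ⟦ -1ℤ ⟧ * jacobsthal)          ≡⟨ ℤₚ.*-assoc (χ ⟦ + 2 ⟧) (χ ⟦ -1ℤ ⟧) jacobsthal ⟨
    χ ⟦ + 2 ⟧ * χ ⟦ -1ℤ ⟧ * jacobsthal            ≡⟨ cong (_* jacobsthal) χ-neg2 ⟨
    χ ⟦ - + 2 ⟧ * jacobsthal                      ∎
    where open ≡-Reasoning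

  -- The roots 0, 2, 4 are centred by the shift t = s + 2.
  legendre-2 : ∑χ-legendre ⟦ + 2 ⟧ ≡ jacobsthal
  legendre-2 = begin
    ∑χ-legendre ⟦ + 2 ⟧              ≡⟨ ∑-reindex ⟦ + 2 ⟧ f 1≢0 ⟨
    ∑ (λ s → f (1# ⊗ s ⊕ ⟦ + 2 ⟧))   ≡⟨ sum-cong-≗ (λ s → cong χ (solve 1 (λ s →
      (con 1ℤ :* s :+ con (+ 2)) :* ((con 1ℤ :* s :+ con (+ 2) :- con (+ 4)) :* (con 1ℤ :* s :+ con (+ 2) :- con (+ 2))) :=
      s :* s :* s :- con (+ 4) :* s) refl s)) ⟩
    curve-sum 4#                     ≡⟨ jacobsthal-isogeny ⟨
    jacobsthal                       ∎
    where
    open ≡-Reasoning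
    f : Fin q → ℤ
    f t = χ (t ⊗ ((t ⊝ 4#) ⊗ (t ⊝ ⟦ + 2 ⟧)))

  -- The roots 0, 4, 8 are centred by the shift t = s + 4.
  legendre-8 : ∑χ-legendre ⟦ + 8 ⟧ ≡ χ ⟦ + 2 ⟧ * jacobsthal
  legendre-8 = begin
    ∑χ-legendre ⟦ + 8 ⟧              ≡⟨ ∑-reindex 4# f 1≢0 ⟨
    ∑ (λ s → f (1# ⊗ s ⊕ 4#))        ≡⟨ sum-cong-≗ (λ s → cong χ (solve 1 (λ s →
      (con 1ℤ :* s :+ con (+ 4)) :* ((con 1ℤ :* s :+ con (+ 4) :- con (+ 4)) :* (con 1ℤ :* s :+ con (+ 4) :- con (+ 8))) :=
      s :* s :* s :- con (+ 16) :* s) refl s)) ⟩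
    curve-sum ⟦ + 16 ⟧               ≡⟨ curve-sum-16 ⟩
    χ ⟦ + 2 ⟧ * jacobsthal           ∎
    where
    open ≡-Reasoning
    f : Fin q → ℤ
    f t = χ (t ⊗ ((t ⊝ 4#) ⊗ (t ⊝ ⟦ + 8 ⟧)))

  -- Flips and the Vieta equation

  flip-fixed : ∀ {b x} → b ⊝ x ≡ x → b ≡ x ⊕ x
  flip-fixed {b} {x} eq = lincomb 1# eq (solve 2 (λ b x → b := x :+ x :+ con 1ℤ :* (b :- x :- x)) refl b x)

  fixed-flip : ∀ {b x} → b ≡ x ⊕ x → b ⊝ x ≡ x
  fixed-flip {b} {x} eq = lincomb 1# eq (solve 2 (λ b x → b :- x := x :+ con 1ℤ :* (b :- (x :+ x))) refl b x)

  flip-involutive : ∀ b x → b ⊝ (b ⊝ x) ≡ x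
  flip-involutive = solve 2 (λ b x → b :- (b :- x) := x) refl

  module _ {D x y z : Fin q} (sol : x ⊗ x ⊕ y ⊗ y ⊕ z ⊗ z ≡ x ⊗ y ⊗ z ⊕ D) where

    -- x and y z - x are the two roots of the equation read as a quadratic in x; likewise for the
    -- other coordinates.
    flip-x-solution : (y ⊗ z ⊝ x) ⊗ (y ⊗ z ⊝ x) ⊕ y ⊗ y ⊕ z ⊗ z ≡ (y ⊗ z ⊝ x) ⊗ y ⊗ z ⊕ D
    flip-x-solution = lincomb 1# sol (solve 4 (λ D x y z → let x′ = y :* z :- x in
      x′ :* x′ :+ y :* y :+ z :* z := x′ :* y :* z :+ D :+ con 1ℤ :* (x :* x :+ y :* y :+ z :* z :- (x :* y :* z :+ D))) refl D x y z)

    flip-y-solution : x ⊗ x ⊕ (x ⊗ z ⊝ y) ⊗ (x ⊗ z ⊝ y) ⊕ z ⊗ z ≡ x ⊗ (x ⊗ z ⊝ y) ⊗ z ⊕ D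
    flip-y-solution = lincomb 1# sol (solve 4 (λ D x y z → let y′ = x :* z :- y in
      x :* x :+ y′ :* y′ :+ z :* z := x :* y′ :* z :+ D :+ con 1ℤ :* (x :* x :+ y :* y :+ z :* z :- (x :* y :* z :+ D))) refl D x y z)

    flip-z-solution : x ⊗ x ⊕ y ⊗ y ⊕ (x ⊗ y ⊝ z) ⊗ (x ⊗ y ⊝ z) ≡ x ⊗ y ⊗ (x ⊗ y ⊝ z) ⊕ D
    flip-z-solution = lincomb 1# sol (solve 4 (λ D x y z → let z′ = x :* y :- z in
      x :* x :+ y :* y :+ z′ :* z′ := x :* y :* z′ :+ D :+ con 1ℤ :* (x :* x :+ y :* y :+ z :* z :- (x :* y :* z :+ D))) refl D x y z)

  -- Character values and inequalities for the constants

  χ-neg4 : χ ⟦ - + 4 ⟧ ≡ χ ⟦ -1ℤ ⟧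
  χ-neg4 = trans (cong χ (⟦⟧-* (+ 4) -1ℤ)) (χ-4⊗ ⟦ -1ℤ ⟧)

  χ-0-4 : χ (0# ⊝ 4#) ≡ χ ⟦ -1ℤ ⟧
  χ-0-4 = trans (cong χ (solve 0 (con 0ℤ :- con (+ 4) := con (+ 4) :* con -1ℤ) refl)) (χ-4⊗ ⟦ -1ℤ ⟧)

  χ-neg4-4 : χ (⟦ - + 4 ⟧ ⊝ 4#) ≡ χ ⟦ - + 2 ⟧
  χ-neg4-4 = trans (cong χ (solve 0 (con (- + 4) :- con (+ 4) := con (+ 4) :* con (- + 2)) refl)) (χ-4⊗ ⟦ - + 2 ⟧)

  χ-2-4 : χ (⟦ + 2 ⟧ ⊝ 4#) ≡ χ ⟦ - + 2 ⟧
  χ-2-4 = cong χ (solve 0 (con (+ 2) :- con (+ 4) := con (- + 2)) refl)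

  χ-8 : χ ⟦ + 8 ⟧ ≡ χ ⟦ + 2 ⟧
  χ-8 = trans (cong χ (⟦⟧-* (+ 4) (+ 2))) (χ-4⊗ ⟦ + 2 ⟧)

  χ-8-4 : χ (⟦ + 8 ⟧ ⊝ 4#) ≡ 1ℤ
  χ-8-4 = trans (cong χ (solve 0 (con (+ 8) :- con (+ 4) := con (+ 4)) refl)) χ4≡1

  8≢0 : ⟦ + 8 ⟧ ≢ 0#
  8≢0 = ⊗-≢0 4≢0 2≢0 ∘ trans (sym (⟦⟧-* (+ 4) (+ 2)))

  neg4≢0 : ⟦ - + 4 ⟧ ≢ 0#
  neg4≢0 = ⊗-≢0 4≢0 -1≢0 ∘ trans (sym (⟦⟧-* (+ 4) -1ℤ))

  0≢4 : 0# ≢ 4#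
  0≢4 = 4≢0 ∘ sym

  neg4≢4 : ⟦ - + 4 ⟧ ≢ 4#
  neg4≢4 eq = 8≢0 (lincomb (⊖ 1#) eq (solve 0 (con (+ 8) := con 0ℤ :+ :- con 1ℤ :* (con (- + 4) :- con (+ 4))) refl))

  2≢4 : ⟦ + 2 ⟧ ≢ 4#
  2≢4 eq = 2≢0 (lincomb (⊖ 1#) eq (solve 0 (con (+ 2) := con 0ℤ :+ :- con 1ℤ :* (con (+ 2) :- con (+ 4))) refl))

  8≢4 : ⟦ + 8 ⟧ ≢ 4#
  8≢4 eq = 4≢0 (lincomb 1# eq (solve 0 (con (+ 4) := con 0ℤ :+ con 1ℤ :* (con (+ 8) :- con (+ 4))) refl))

-- The field with p elements

module ModularField (p : ℕ) .{{_ : NonZero p}} where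
  open Mod p

  -- A negative multiple of p is moved to the other side, so the remainder laws of ℕ suffice.
  residue-unique : ∀ {r s} k → r ℕ.< p → s ℕ.< p → + r ≡ + s + k * + p → r ≡ s
  residue-unique {r} {s} (+ n) r<p s<p eq = begin
    r                     ≡⟨ m<n⇒m%n≡m r<p ⟨
    r % p                 ≡⟨ cong (_% p) (ℤₚ.+-injective (trans eq (cong (λ t → + s + t) (sym (ℤₚ.pos-* n p))))) ⟩
    (s ℕ.+ n ℕ.* p) % p   ≡⟨ [m+kn]%n≡m%n s n p ⟩
    s % p                 ≡⟨ m<n⇒m%n≡m s<p ⟩
    s                     ∎
    where open ≡-Reasoning
  residue-unique {r} {s} -[1+ n ] r<p s<p eq =
    sym (residue-unique (+ suc n) s<p r<p (trans (move (+ s) (+ suc n) (+ p)) (cong (_+ + suc n * + p) (sym eq))))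
    where
    move : ∀ s m p → s ≡ s + - m * p + m * p
    move = solve-∀

  toℕ-ι : ∀ a → + toℕ (ι a) ≡ a + - (a /ℕ p) * + p
  toℕ-ι a = begin
    + toℕ (ι a)                                               ≡⟨ cong +_ (toℕ-fromℕ< (n%ℕd<d a p)) ⟩
    + (a %ℕ p)                                                ≡⟨ move (+ (a %ℕ p)) (a /ℕ p) (+ p) ⟩
    + (a %ℕ p) + (a /ℕ p) * + p + - (a /ℕ p) * + p            ≡⟨ cong (_+ - (a /ℕ p) * + p) (a≡a%ℕn+[a/ℕn]*n a p) ⟨
    a + - (a /ℕ p) * + p                                      ∎
    where
    open ≡-Reasoning
    move : ∀ r d p → r ≡ r + d * p + - d * p
    move = solve-∀

  -- The multiple k is an explicit certificate of congruence. The homomorphism laws below supply it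
  -- as a polynomial in the quotients of the arguments.
  ι-cong : ∀ a b k → a ≡ b + k * + p → ι a ≡ ι b
  ι-cong a b k eq = toℕ-injective (residue-unique (b /ℕ p + k + - (a /ℕ p)) (toℕ<n (ι a)) (toℕ<n (ι b)) (begin
    + toℕ (ι a)                                                     ≡⟨ toℕ-ι a ⟩
    a + - (a /ℕ p) * + p                                            ≡⟨ cong (_+ - (a /ℕ p) * + p) eq ⟩
    b + k * + p + - (a /ℕ p) * + p                                  ≡⟨ move b (a /ℕ p) (b /ℕ p) k (+ p) ⟩
    b + - (b /ℕ p) * + p + (b /ℕ p + k + - (a /ℕ p)) * + p          ≡⟨ cong (_+ (b /ℕ p + k + - (a /ℕ p)) * + p) (toℕ-ι b) ⟨
    + toℕ (ι b) + (b /ℕ p + k + - (a /ℕ p)) * + p                   ∎))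
    where
    open ≡-Reasoning
    move : ∀ b d e k p → b + k * p + - d * p ≡ b + - e * p + (e + k + - d) * p
    move = solve-∀

  ι-toℕ : ∀ x → ι (+ toℕ x) ≡ x
  ι-toℕ x = toℕ-injective (trans (toℕ-fromℕ< (n%ℕd<d (+ toℕ x) p)) (m<n⇒m%n≡m (toℕ<n x)))

  ι-+ : ∀ a b → ι (a + b) ≡ ι a +ₚ ι b
  ι-+ a b = sym (ι-cong (+ (toℕ (ι a) ℕ.+ toℕ (ι b))) (a + b) (- (a /ℕ p) + - (b /ℕ p)) (trans
    (cong₂ _+_ (toℕ-ι a) (toℕ-ι b)) (move a b (a /ℕ p) (b /ℕ p) (+ p))))
    where
    move : ∀ a b d e p → a + - d * p + (b + - e * p) ≡ a + b + (- d + - e) * p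
    move = solve-∀

  ι-* : ∀ a b → ι (a * b) ≡ ι a *ₚ ι b
  ι-* a b = sym (ι-cong (+ (toℕ (ι a) ℕ.* toℕ (ι b))) (a * b) (- (a /ℕ p) * b + - (b /ℕ p) * a + (a /ℕ p) * (b /ℕ p) * + p) (trans
    (ℤₚ.pos-* (toℕ (ι a)) (toℕ (ι b)))
    (trans (cong₂ _*_ (toℕ-ι a) (toℕ-ι b)) (move a b (a /ℕ p) (b /ℕ p) (+ p)))))
    where
    move : ∀ a b d e p → (a + - d * p) * (b + - e * p) ≡ a * b + (- d * b + - e * a + d * e * p) * p
    move = solve-∀

  ι-- : ∀ a b → ι (a - b) ≡ ι a -ₚ ι b
  -- The `1ℤ` in the multiple is the p that `_-ₚ_` adds before subtracting; the truncated difference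
  -- is exact because residues lie below p.
  ι-- a b = sym (ι-cong (+ (toℕ (ι a) ℕ.+ (p ℕ.∸ toℕ (ι b)))) (a - b) (1ℤ + - (a /ℕ p) + b /ℕ p) (trans
    (cong₂ _+_ (toℕ-ι a) (trans (sym (trans (ℤₚ.m-n≡m⊖n p (toℕ (ι b))) (ℤₚ.⊖-≥ (ℕₚ.<⇒≤ (toℕ<n (ι b))))))
                                (cong (λ t → + p - t) (toℕ-ι b))))
    (move a b (a /ℕ p) (b /ℕ p) (+ p))))
    where
    move : ∀ a b d e p → a + - d * p + (p - (b + - e * p)) ≡ a - b + (1ℤ + - d + e) * p
    move = solve-∀

  -- Ring laws modulo p

  negₚ : 𝔽 → 𝔽
  negₚ x = ι 0ℤ -ₚ x

  ι-neg : ∀ a → ι (- a) ≡ negₚ (ι a)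
  ι-neg a = trans (cong ι (sym (ℤₚ.+-identityˡ (- a)))) (ι-- 0ℤ a)

  -- Every element is the image of an integer, so the ring laws need checking only on images of `ι`,
  -- where they descend from ℤ.
  lift₁ : ∀ {P : 𝔽 → Set} → (∀ a → P (ι a)) → ∀ x → P x
  lift₁ {P} f x = subst P (ι-toℕ x) (f (+ toℕ x))

  lift₂ : ∀ {P : 𝔽 → 𝔽 → Set} → (∀ a b → P (ι a) (ι b)) → ∀ x y → P x y
  lift₂ f = lift₁ λ a → lift₁ λ b → f a b

  lift₃ : ∀ {P : 𝔽 → 𝔽 → 𝔽 → Set} → (∀ a b c → P (ι a) (ι b) (ι c)) → ∀ x y z → P x y z
  lift₃ f = lift₁ λ a → lift₂ λ b c → f a b c

  -- Flips are stated with `_-ₚ_`, whereas the ring subtracts by adding a negative; this reconciles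
  -- the two.
  subₚ : ∀ x y → x -ₚ y ≡ x +ₚ (negₚ y)
  subₚ = lift₂ {P = λ x y → x -ₚ y ≡ x +ₚ (negₚ y)}
    λ a b → trans (sym (ι-- a b)) (trans (ι-+ a (- b)) (cong (ι a +ₚ_) (ι-neg b)))

  +ₚ-assoc : ∀ x y z → (x +ₚ y) +ₚ z ≡ x +ₚ (y +ₚ z)
  +ₚ-assoc = lift₃ {P = λ x y z → (x +ₚ y) +ₚ z ≡ x +ₚ (y +ₚ z)} λ a b c → begin
    (ι a +ₚ ι b) +ₚ ι c    ≡⟨ cong (_+ₚ ι c) (ι-+ a b) ⟨
    ι (a + b) +ₚ ι c       ≡⟨ ι-+ (a + b) c ⟨
    ι (a + b + c)          ≡⟨ cong ι (ℤₚ.+-assoc a b c) ⟩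
    ι (a + (b + c))        ≡⟨ ι-+ a (b + c) ⟩
    ι a +ₚ ι (b + c)       ≡⟨ cong (ι a +ₚ_) (ι-+ b c) ⟩
    ι a +ₚ (ι b +ₚ ι c)    ∎
    where open ≡-Reasoning

  *ₚ-assoc : ∀ x y z → (x *ₚ y) *ₚ z ≡ x *ₚ (y *ₚ z)
  *ₚ-assoc = lift₃ {P = λ x y z → (x *ₚ y) *ₚ z ≡ x *ₚ (y *ₚ z)} λ a b c → begin
    (ι a *ₚ ι b) *ₚ ι c    ≡⟨ cong (_*ₚ ι c) (ι-* a b) ⟨
    ι (a * b) *ₚ ι c       ≡⟨ ι-* (a * b) c ⟨
    ι (a * b * c)          ≡⟨ cong ι (ℤₚ.*-assoc a b c) ⟩
    ι (a * (b * c))        ≡⟨ ι-* a (b * c) ⟩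
    ι a *ₚ ι (b * c)       ≡⟨ cong (ι a *ₚ_) (ι-* b c) ⟩
    ι a *ₚ (ι b *ₚ ι c)    ∎
    where open ≡-Reasoning

  *ₚ-distribˡ-+ₚ : ∀ x y z → x *ₚ (y +ₚ z) ≡ (x *ₚ y) +ₚ (x *ₚ z)
  *ₚ-distribˡ-+ₚ = lift₃ {P = λ x y z → x *ₚ (y +ₚ z) ≡ (x *ₚ y) +ₚ (x *ₚ z)} λ a b c → begin
    ι a *ₚ (ι b +ₚ ι c)           ≡⟨ cong (ι a *ₚ_) (ι-+ b c) ⟨
    ι a *ₚ ι (b + c)              ≡⟨ ι-* a (b + c) ⟨
    ι (a * (b + c))               ≡⟨ cong ι (ℤₚ.*-distribˡ-+ a b c) ⟩
    ι (a * b + a * c)             ≡⟨ ι-+ (a * b) (a * c) ⟩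
    ι (a * b) +ₚ ι (a * c)        ≡⟨ cong₂ _+ₚ_ (ι-* a b) (ι-* a c) ⟩
    (ι a *ₚ ι b) +ₚ (ι a *ₚ ι c)  ∎
    where open ≡-Reasoning

  +ₚ-comm : ∀ x y → x +ₚ y ≡ y +ₚ x
  +ₚ-comm x y = cong (_mod p) (ℕₚ.+-comm (toℕ x) (toℕ y))

  *ₚ-comm : ∀ x y → x *ₚ y ≡ y *ₚ x
  *ₚ-comm x y = cong (_mod p) (ℕₚ.*-comm (toℕ x) (toℕ y))

  +ₚ-identityˡ : ∀ x → ι 0ℤ +ₚ x ≡ x
  +ₚ-identityˡ = lift₁ {P = λ x → ι 0ℤ +ₚ x ≡ x} λ a → trans (sym (ι-+ 0ℤ a)) (cong ι (ℤₚ.+-identityˡ a))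

  *ₚ-identityˡ : ∀ x → ι 1ℤ *ₚ x ≡ x
  *ₚ-identityˡ = lift₁ {P = λ x → ι 1ℤ *ₚ x ≡ x} λ a → trans (sym (ι-* 1ℤ a)) (cong ι (ℤₚ.*-identityˡ a))

  +ₚ-inverseʳ : ∀ x → x +ₚ (negₚ x) ≡ ι 0ℤ
  +ₚ-inverseʳ = lift₁ {P = λ x → x +ₚ (negₚ x) ≡ ι 0ℤ} λ a →
    trans (sym (subₚ (ι a) (ι a))) (trans (sym (ι-- a a)) (cong ι (ℤₚ.+-inverseʳ a)))

  isCommutativeRing : IsCommutativeRing _≡_ _+ₚ_ _*ₚ_ negₚ (ι 0ℤ) (ι 1ℤ)
  isCommutativeRing = record
    { isRing = record
      { +-isAbelianGroup = record
        { isGroup = record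
          { isMonoid = record
            { isSemigroup = record
              { isMagma = record { isEquivalence = isEquivalence ; ∙-cong = cong₂ _+ₚ_ }
              ; assoc = +ₚ-assoc
              }
            ; identity = +ₚ-identityˡ , λ x → trans (+ₚ-comm x (ι 0ℤ)) (+ₚ-identityˡ x)
            }
          ; inverse = (λ x → trans (+ₚ-comm (negₚ x) x) (+ₚ-inverseʳ x)) , +ₚ-inverseʳ
          ; ⁻¹-cong = cong negₚ
          }
        ; comm = +ₚ-comm
        }
      ; *-cong = cong₂ _*ₚ_
      ; *-assoc = *ₚ-assoc
      ; *-identity = *ₚ-identityˡ , λ x → trans (*ₚ-comm x (ι 1ℤ)) (*ₚ-identityˡ x)
      ; distrib = *ₚ-distribˡ-+ₚ , λ x y z → trans (*ₚ-comm (y +ₚ z) x)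
          (trans (*ₚ-distribˡ-+ₚ x y z) (cong₂ _+ₚ_ (*ₚ-comm x y) (*ₚ-comm x z)))
      }
    ; *-comm = *ₚ-comm
    }
  open IsCommutativeRing isCommutativeRing using () renaming (zeroʳ to *ₚ-zeroʳ)

  -- A nonzero residue is coprime to p. The Bézout identity in ℕ comes in two sign patterns, and the
  -- coefficient of a, negated in the first, is the inverse.
  *ₚ-inverse : Prime p → ∀ a → a ≢ ι 0ℤ → ∃[ b ] b *ₚ a ≡ ι 1ℤ
  *ₚ-inverse pr a a≢0 = bézout (coprime-Bézout (prime⇒coprime pr (toℕ<n a)))
    where
    instance
      toℕ-nonZero : NonZero (toℕ a)
      toℕ-nonZero = ℕ.≢-nonZero λ eq → a≢0 (trans (sym (ι-toℕ a)) (cong (ι ∘ +_) eq))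
    open ≡-Reasoning
    bézout : Bézout.Identity 1 p (toℕ a) → ∃[ b ] b *ₚ a ≡ ι 1ℤ
    bézout (Bézout.+- x y eq) = ι (- + y) , (begin
      ι (- + y) *ₚ a               ≡⟨ cong (ι (- + y) *ₚ_) (ι-toℕ a) ⟨
      ι (- + y) *ₚ ι (+ toℕ a)     ≡⟨ ι-* (- + y) (+ toℕ a) ⟨
      ι (- + y * + toℕ a)          ≡⟨ ι-cong (- + y * + toℕ a) 1ℤ (- + x) (trans (move (+ y) (+ toℕ a)) (trans
        (cong (λ t → 1ℤ - t) (trans (cong (λ t → 1ℤ + t) (sym (ℤₚ.pos-* y (toℕ a)))) (trans (cong +_ eq) (ℤₚ.pos-* x p))))
        (move′ (+ x) (+ p)))) ⟩
      ι 1ℤ                         ∎)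
      where
      move : ∀ y a → - y * a ≡ 1ℤ - (1ℤ + y * a)
      move = solve-∀
      move′ : ∀ x p → 1ℤ - x * p ≡ 1ℤ + - x * p
      move′ = solve-∀
    bézout (Bézout.-+ x y eq) = ι (+ y) , (begin
      ι (+ y) *ₚ a                 ≡⟨ cong (ι (+ y) *ₚ_) (ι-toℕ a) ⟨
      ι (+ y) *ₚ ι (+ toℕ a)       ≡⟨ ι-* (+ y) (+ toℕ a) ⟨
      ι (+ y * + toℕ a)            ≡⟨ ι-cong (+ y * + toℕ a) 1ℤ (+ x) (trans (sym (ℤₚ.pos-* y (toℕ a))) (trans (cong +_ (sym eq)) (cong (λ t → 1ℤ + t) (ℤₚ.pos-* x p)))) ⟩
      ι 1ℤ                         ∎)

  -- The quadratic character modulo p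

  σ-zero : ∀ {a} → a ≡ ι 0ℤ → σ a ≡ 0ℤ
  σ-zero {a} a≡0 with a ≟ᶠ ι 0ℤ | isSquare? a
  ... | yes _   | _ = refl
  ... | no  a≢0 | _ = contradiction a≡0 a≢0

  σ-square : ∀ {a} → a ≢ ι 0ℤ → IsSquare a → σ a ≡ 1ℤ
  σ-square {a} a≢0 sq with a ≟ᶠ ι 0ℤ | isSquare? a
  ... | yes a≡0 | _       = contradiction a≡0 a≢0
  ... | no  _   | yes _   = refl
  ... | no  _   | no ¬sq  = contradiction sq ¬sq

  σ-nonsquare : ∀ {a} → (∀ b → b *ₚ b ≢ a) → σ a ≡ -1ℤ
  σ-nonsquare {a} none with a ≟ᶠ ι 0ℤ | isSquare? a
  -- Zero is the square of zero, which the hypothesis excludes.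
  ... | yes a≡0 | _            = contradiction (trans (*ₚ-zeroʳ (ι 0ℤ)) (sym a≡0)) (none (ι 0ℤ))
  ... | no  _   | yes (b , eq) = contradiction eq (none b)
  ... | no  _   | no _         = refl

  primeField : Prime p → p ≥ 5 → OddFieldWithCharacter p
  primeField pr p≥5 = record
    { _⊕_ = _+ₚ_
    ; _⊗_ = _*ₚ_
    ; ⊖_  = negₚ
    ; ⟦_⟧ = ι
    ; isCommutativeRing = isCommutativeRing
    ; ⟦⟧-+    = ι-+
    ; ⟦⟧-*    = ι-*
    ; ⟦⟧-neg  = ι-neg
    ; inverse = *ₚ-inverse pr
    ; 2≢0     = λ eq → 2%p≢0 (trans (sym (toℕ-fromℕ< (n%ℕd<d (+ 2) p))) (trans (cong toℕ eq) (toℕ-fromℕ< (n%ℕd<d 0ℤ p))))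
    ; χ           = σ
    ; χ-zero      = σ-zero refl
    ; χ-square    = λ b b≢0 → σ-square (b*b≢0 b b≢0) (b , refl)
    ; χ-nonsquare = σ-nonsquare
    }
    where
    2%p≢0 : 2 % p ≢ 0 % p
    2%p≢0 eq = contradiction
      (trans (sym (m<n⇒m%n≡m (ℕₚ.≤-trans (ℕ.s≤s (ℕ.s≤s (ℕ.s≤s ℕ.z≤n))) p≥5))) (trans eq (m<n⇒m%n≡m (ℕₚ.≤-trans (ℕ.s≤s ℕ.z≤n) p≥5))))
      λ ()
    b*b≢0 : ∀ b → b ≢ ι 0ℤ → b *ₚ b ≢ ι 0ℤ
    b*b≢0 b b≢0 b²≡0 = b≢0 (begin
      b                  ≡⟨ *ₚ-identityˡ b ⟨
      ι 1ℤ *ₚ b          ≡⟨ cong (_*ₚ b) (proj₂ b⁻¹) ⟨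
      (c *ₚ b) *ₚ b      ≡⟨ *ₚ-assoc c b b ⟩
      c *ₚ (b *ₚ b)      ≡⟨ cong (c *ₚ_) b²≡0 ⟩
      c *ₚ ι 0ℤ          ≡⟨ *ₚ-zeroʳ c ⟩
      ι 0ℤ               ∎)
      where
      open ≡-Reasoning
      b⁻¹ : ∃[ c ] c *ₚ b ≡ ι 1ℤ
      b⁻¹ = *ₚ-inverse pr b b≢0
      c : 𝔽
      c = proj₁ b⁻¹

-- Degrees in the Vieta graph

module VietaGraph (p : ℕ) .{{_ : NonZero p}} (pr : Prime p) (p≥5 : p ≥ 5) where
  open Mod p
  open ModularField p
  open CharacterSums (primeField pr p≥5)

  sumₗ-triples : ∀ f → sumₗ f triples ≡ ∑₃ (λ x y z → f (x , y , z))
  sumₗ-triples f = begin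
    sumₗ f triples
      ≡⟨ sumₗ-cartesianProduct f (allFin p) (cartesianProduct (allFin p) (allFin p)) ⟩
    sumₗ (λ x → sumₗ (λ yz → f (x , yz)) (cartesianProduct (allFin p) (allFin p))) (allFin p)
      ≡⟨ sumₗ-tabulate (λ x → sumₗ (λ yz → f (x , yz)) (cartesianProduct (allFin p) (allFin p))) id ⟩
    ∑ (λ x → sumₗ (λ yz → f (x , yz)) (cartesianProduct (allFin p) (allFin p)))
      ≡⟨ sum-cong-≗ (λ x → trans (sumₗ-cartesianProduct (λ yz → f (x , yz)) (allFin p) (allFin p))
           (trans (sumₗ-tabulate (λ y → sumₗ (λ z → f (x , y , z)) (allFin p)) id)
           (sum-cong-≗ (λ y → sumₗ-tabulate (λ z → f (x , y , z)) id)))) ⟩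
    ∑₃ (λ x y z → f (x , y , z)) ∎
    where open ≡-Reasoning

  flip-flip : ∀ b x → b -ₚ (b -ₚ x) ≡ x
  flip-flip b x = trans (cong (b -ₚ_) (subₚ b x)) (trans (subₚ b (b +ₚ negₚ x)) (flip-involutive b x))

  -- Each flip is an involution, so the two alternatives in `VietaAdj` agree and neighbours can be
  -- sought in `flips v` alone.
  flips-symmetric : ∀ v w → v ∈ flips w → w ∈ flips v
  flips-symmetric v (x , y , z) (here refl)                 = here (cong (_, y , z) (sym (flip-flip (y *ₚ z) x)))
  flips-symmetric v (x , y , z) (there (here refl))         = there (here (cong (λ t → x , t , z) (sym (flip-flip (x *ₚ z) y))))
  flips-symmetric v (x , y , z) (there (there (here refl))) = there (there (here (cong (λ t → x , y , t) (sym (flip-flip (x *ₚ y) z)))))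

  module _ (D : 𝔽) where
    open FiniteSimpleGraph (vietaGraph D) using (vertices; unique; adj?; degree)

    flips-solution : ∀ v {w} → IsSolution D v → w ∈ flips v → IsSolution D w
    flips-solution (x , y , z) sol (here refl) =
      subst (λ t → IsSolution D (t , y , z)) (sym (subₚ (y *ₚ z) x)) (flip-x-solution {D} {x} {y} {z} sol)
    flips-solution (x , y , z) sol (there (here refl)) =
      subst (λ t → IsSolution D (x , t , z)) (sym (subₚ (x *ₚ z) y)) (flip-y-solution {D} {x} {y} {z} sol)
    flips-solution (x , y , z) sol (there (there (here refl))) =
      subst (λ t → IsSolution D (x , y , t)) (sym (subₚ (x *ₚ y) z)) (flip-z-solution {D} {x} {y} {z} sol)

    -- Flips of a solution are solutions, hence vertices, and conversely every neighbour is a flip.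
    -- Those that move v are pairwise distinct.
    degree-flips : ∀ v → IsSolution D v → degree v ≡ length (filter (λ w → ¬? (w ≟ᵗ v)) (flips v))
    degree-flips v@(x , y , z) sol = unique-length
      (AllPairs.filter⁺ (adj? v) unique)
      (unique-on (all-filter (λ w → ¬? (w ≟ᵗ v)) (flips v)) (AllPairs.filter⁺ (λ w → ¬? (w ≟ᵗ v)) distinct))
      neighbour⇒flip flip⇒neighbour
      where
      -- If flips in two different coordinates coincide, the first has left its own coordinate
      -- unchanged and hence fixes v.
      distinct : AllPairs (λ u w → u ≢ v → u ≢ w) (flips v)
      distinct =
        ((λ u≢v u≡w → u≢v (cong (_, y , z) (cong proj₁ u≡w))) ∷
         (λ u≢v u≡w → u≢v (cong (_, y , z) (cong proj₁ u≡w))) ∷ []) ∷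
        ((λ u≢v u≡w → u≢v (cong (λ t → x , t , z) (cong (proj₁ ∘ proj₂) u≡w))) ∷ []) ∷
        [] ∷ []
      neighbour⇒flip : ∀ {w} → w ∈ filter (adj? v) vertices → w ∈ filter (λ w → ¬? (w ≟ᵗ v)) (flips v)
      neighbour⇒flip {w} w∈ with ∈-filter⁻ (adj? v) {xs = vertices} w∈
      ... | _ , v≢w , adjacent =
        ∈-filter⁺ (λ w → ¬? (w ≟ᵗ v)) {xs = flips v} ([ id , flips-symmetric v w ] adjacent) (v≢w ∘ sym)
      flip⇒neighbour : ∀ {w} → w ∈ filter (λ w → ¬? (w ≟ᵗ v)) (flips v) → w ∈ filter (adj? v) vertices
      flip⇒neighbour {w} w∈ with ∈-filter⁻ (λ w → ¬? (w ≟ᵗ v)) {xs = flips v} w∈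
      ... | w∈flips , w≢v = ∈-filter⁺ (adj? v) {xs = vertices}
        (∈-filter⁺ (isSolution? D) {xs = triples}
          (∈-cartesianProduct⁺ (∈-allFin (proj₁ w)) (∈-cartesianProduct⁺ (∈-allFin (proj₁ (proj₂ w))) (∈-allFin (proj₂ (proj₂ w)))))
          (flips-solution v sol w∈flips))
        (w≢v ∘ sym , inj₁ w∈flips)

    order-count : + order (vietaGraph D) ≡ ∑₃ (solution D)
    order-count = trans (length-filter (isSolution? D) triples) (sumₗ-triples (λ v → 𝟙 (isSolution? D v)))

    flip-fixed-≡ : ∀ {b x} → b -ₚ x ≡ x → b ≡ x +ₚ x
    flip-fixed-≡ {b} {x} eq = flip-fixed (trans (sym (subₚ b x)) eq)

    fixed-flip-≡ : ∀ {b x} → b ≡ x +ₚ x → b -ₚ x ≡ x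
    fixed-flip-≡ {b} {x} eq = trans (subₚ b x) (fixed-flip eq)

    module _ {R : ℕ → Set} (R? : ∀ k → Dec (R k)) (c₁ c₂ c₃ : ℤ)
      (r₃ : 𝟙 (R? 3) ≡ 0ℤ) (r₂ : 𝟙 (R? 2) ≡ c₁) (r₁ : 𝟙 (R? 1) ≡ + 2 * c₁ + c₂) (r₀ : 𝟙 (R? 0) ≡ + 3 * c₁ + + 3 * c₂ + c₃) where

      degree-symmetric : ∀ x y z → IsSolution D (x , y , z) →
        𝟙 (R? (degree (x , y , z))) ≡ symmetric c₁ c₂ c₃ (fixed x y z) (fixed y z x) (fixed z x y)
      degree-symmetric x y z sol = begin
        𝟙 (R? (degree v))
          ≡⟨ cong (λ k → 𝟙 (R? k)) (degree-flips v sol) ⟩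
        𝟙 (R? (length (filter (λ w → ¬? (w ≟ᵗ v)) (flips v))))
          ≡⟨ cong (λ k → 𝟙 (R? k)) (trans (length-filter-¬ (_≟ᵗ v) v₁ (v₂ ∷ v₃ ∷ []))
               (cong (#failing (v₁ ≟ᵗ v) ℕ.+_) (trans (length-filter-¬ (_≟ᵗ v) v₂ (v₃ ∷ []))
               (cong (#failing (v₂ ≟ᵗ v) ℕ.+_) (length-filter-¬ (_≟ᵗ v) v₃ []))))) ⟩
        𝟙 (R? (#failing (v₁ ≟ᵗ v) ℕ.+ (#failing (v₂ ≟ᵗ v) ℕ.+ (#failing (v₃ ≟ᵗ v) ℕ.+ 0))))
          ≡⟨ #failing-symmetric R? c₁ c₂ c₃ r₃ r₂ r₁ r₀ (v₁ ≟ᵗ v) (v₂ ≟ᵗ v) (v₃ ≟ᵗ v) ⟩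
        symmetric c₁ c₂ c₃ (𝟙 (v₁ ≟ᵗ v)) (𝟙 (v₂ ≟ᵗ v)) (𝟙 (v₃ ≟ᵗ v))
          ≡⟨ cong₂ (λ i j → symmetric c₁ c₂ c₃ i j (𝟙 (v₃ ≟ᵗ v))) fixed-x fixed-y ⟩
        symmetric c₁ c₂ c₃ (fixed x y z) (fixed y z x) (𝟙 (v₃ ≟ᵗ v))
          ≡⟨ cong (symmetric c₁ c₂ c₃ (fixed x y z) (fixed y z x)) fixed-z ⟩
        symmetric c₁ c₂ c₃ (fixed x y z) (fixed y z x) (fixed z x y) ∎
        where
        open ≡-Reasoning
        v v₁ v₂ v₃ : Triple
        v  = x , y , z
        v₁ = y *ₚ z -ₚ x , y , z
        v₂ = x , x *ₚ z -ₚ y , z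
        v₃ = x , y , x *ₚ y -ₚ z
        fixed-x : 𝟙 (v₁ ≟ᵗ v) ≡ fixed x y z
        fixed-x = 𝟙-cong (v₁ ≟ᵗ v) (y *ₚ z ≟ᶠ x +ₚ x)
          (λ eq → flip-fixed-≡ (cong proj₁ eq)) (λ eq → cong (_, y , z) (fixed-flip-≡ eq))
        fixed-y : 𝟙 (v₂ ≟ᵗ v) ≡ fixed y z x
        fixed-y = 𝟙-cong (v₂ ≟ᵗ v) (z *ₚ x ≟ᶠ y +ₚ y)
          (λ eq → trans (*ₚ-comm z x) (flip-fixed-≡ (cong (proj₁ ∘ proj₂) eq)))
          (λ eq → cong (λ t → x , t , z) (fixed-flip-≡ (trans (*ₚ-comm x z) eq)))
        fixed-z : 𝟙 (v₃ ≟ᵗ v) ≡ fixed z x y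
        fixed-z = 𝟙-cong (v₃ ≟ᵗ v) (x *ₚ y ≟ᶠ z +ₚ z)
          (λ eq → flip-fixed-≡ (cong (proj₂ ∘ proj₂) eq)) (λ eq → cong (λ t → x , y , t) (fixed-flip-≡ eq))

      -- One formula serves all four degree counts: R stands for any property of the degree that
      -- fails at 3.
      degree-count : D ≢ ι (+ 4) → + length (filter (λ v → R? (degree v)) vertices) ≡
        c₁ * (+ 3 * (+ p - + 3 + ∑χ-legendre D)) + c₂ * (+ 3 * (1ℤ + σ D)) + c₃ * δ D (ι 0ℤ)
      degree-count D≢4 = begin
        + length (filter (λ v → R? (degree v)) vertices)
          ≡⟨ length-filter (λ v → R? (degree v)) vertices ⟩
        sumₗ (λ v → 𝟙 (R? (degree v))) vertices
          ≡⟨ sumₗ-filter (isSolution? D) (λ v → 𝟙 (R? (degree v))) triples ⟩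
        sumₗ (λ v → 𝟙 (isSolution? D v) * 𝟙 (R? (degree v))) triples
          ≡⟨ sumₗ-triples (λ v → 𝟙 (isSolution? D v) * 𝟙 (R? (degree v))) ⟩
        ∑₃ (λ x y z → 𝟙 (isSolution? D (x , y , z)) * 𝟙 (R? (degree (x , y , z))))
          ≡⟨ ∑₃-cong (λ x y z → 𝟙-*-cong (isSolution? D (x , y , z)) (degree-symmetric x y z)) ⟩
        ∑₃ (λ x y z → 𝟙 (isSolution? D (x , y , z)) * symmetric c₁ c₂ c₃ (fixed x y z) (fixed y z x) (fixed z x y))
          ≡⟨ symmetric-count D≢4 c₁ c₂ c₃ ⟩
        c₁ * (+ 3 * (+ p - + 3 + ∑χ-legendre D)) + c₂ * (+ 3 * (1ℤ + σ D)) + c₃ * δ D (ι 0ℤ) ∎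
        where open ≡-Reasoning

  -- Counts in closed form

  P*P≡P^2 : + p * + p ≡ (+ p) ^ 2
  P*P≡P^2 = cong (λ r → + p * r) (sym (ℤₚ.*-identityʳ (+ p)))

  module _ (D : 𝔽) (D≢4 : D ≢ ι (+ 4)) where

    vieta-counts : ∀ {s t j d} → σ D ≡ s → σ (D +ₚ negₚ (ι (+ 4))) ≡ t → ∑χ-legendre D ≡ j → δ D (ι 0ℤ) ≡ d →
      let V = vietaGraph D; P = + p in
      ( + order V ≡ P * P + 1ℤ + (+ 3 + s) * t * P
      × + #deficient V ≡ 1ℤ * (+ 3 * (P - + 3 + j)) + -1ℤ * (+ 3 * (1ℤ + s)) + 1ℤ * d
      × + #ofDegree V 2 ≡ 1ℤ * (+ 3 * (P - + 3 + j)) + - + 2 * (+ 3 * (1ℤ + s)) + + 3 * d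
      × + #ofDegree V 1 ≡ 0ℤ * (+ 3 * (P - + 3 + j)) + 1ℤ * (+ 3 * (1ℤ + s)) + - + 3 * d
      × + #ofDegree V 0 ≡ 0ℤ * (+ 3 * (P - + 3 + j)) + 0ℤ * (+ 3 * (1ℤ + s)) + 1ℤ * d )
    vieta-counts refl refl refl refl =
      trans (order-count D) (solution-count D) ,
      -- With m fixing flips, the coefficients (c₁, c₂, c₃) are (1, -1, 1) for m ≥ 1, (1, -2, 3) for
      -- m = 1, (0, 1, -3) for m = 2 and (0, 0, 1) for m = 3.
      degree-count D (ℕ._<? 3) 1ℤ -1ℤ 1ℤ refl refl refl refl D≢4 ,
      degree-count D (ℕ._≟ 2) 1ℤ (- + 2) (+ 3) refl refl refl refl D≢4 ,
      degree-count D (ℕ._≟ 1) 0ℤ 1ℤ (- + 3) refl refl refl refl D≢4 ,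
      degree-count D (ℕ._≟ 0) 0ℤ 0ℤ 1ℤ refl refl refl refl D≢4

    -- Only the origin can be fixed by all three flips, and it is a solution only for D = 0; here
    -- the third term vanishes.
    vieta-counts-≢0 : ∀ {s t j} → D ≢ ι 0ℤ → σ D ≡ s → σ (D +ₚ negₚ (ι (+ 4))) ≡ t → ∑χ-legendre D ≡ j →
      let V = vietaGraph D; P = + p in
      ( + order V ≡ P ^ 2 + + 1 + (+ 3 + s) * t * P
      × + #deficient V ≡ + 3 * (P - + 4 - s + j)
      × + #ofDegree V 2 ≡ + 3 * (P - + 5 - + 2 * s + j)
      × + #ofDegree V 1 ≡ + 3 * (+ 1 + s)
      × + #ofDegree V 0 ≡ + 0 )
    vieta-counts-≢0 {s} {t} {j} D≢0 s≡ t≡ j≡ =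
      let order≡ , deficient≡ , degree2≡ , degree1≡ , degree0≡ = vieta-counts s≡ t≡ j≡ (δ-≢ D≢0) in
      trans order≡ (cong (λ r → r + 1ℤ + (+ 3 + s) * t * + p) P*P≡P^2) ,
      trans deficient≡ (ring-deficient (+ p) s j) ,
      trans degree2≡ (ring-2 (+ p) s j) ,
      trans degree1≡ (ring-1 (+ p) s j) ,
      trans degree0≡ (ring-0 (+ p) s j)
      where
      ring-deficient : ∀ P s j → 1ℤ * (+ 3 * (P - + 3 + j)) + -1ℤ * (+ 3 * (1ℤ + s)) + 1ℤ * 0ℤ ≡ + 3 * (P - + 4 - s + j)
      ring-deficient = solve-∀
      ring-2 : ∀ P s j → 1ℤ * (+ 3 * (P - + 3 + j)) + - + 2 * (+ 3 * (1ℤ + s)) + + 3 * 0ℤ ≡ + 3 * (P - + 5 - + 2 * s + j)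
      ring-2 = solve-∀
      ring-1 : ∀ P s j → 0ℤ * (+ 3 * (P - + 3 + j)) + 1ℤ * (+ 3 * (1ℤ + s)) + - + 3 * 0ℤ ≡ + 3 * (1ℤ + s)
      ring-1 = solve-∀
      ring-0 : ∀ P s j → 0ℤ * (+ 3 * (P - + 3 + j)) + 0ℤ * (+ 3 * (1ℤ + s)) + 1ℤ * 0ℤ ≡ 0ℤ
      ring-0 = solve-∀

  -- For D = 0 the origin is the only solution fixed by two flips, and it is fixed by all three. It
  -- is counted once for each of the three pairs of flips, and the coefficient -3 removes it from
  -- degree 1.
  vieta-counts-0 :
      let V = vietaGraph (ι 0ℤ); P = + p; s = σ (ι -1ℤ) in
      ( + order V ≡ P ^ 2 + + 1 + + 3 * s * P
      × + #deficient V ≡ + 3 * P - + 11 - + 3 * s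
      × + #ofDegree V 2 ≡ + 3 * (P - + 4 - s)
      × + #ofDegree V 1 ≡ + 0
      × + #ofDegree V 0 ≡ + 1 )
  vieta-counts-0 =
    let order≡ , deficient≡ , degree2≡ , degree1≡ , degree0≡ =
          vieta-counts (ι 0ℤ) 0≢4 (σ-zero refl) χ-0-4 legendre-0 (δ-refl (ι 0ℤ)) in
    trans order≡ (cong (λ r → r + 1ℤ + + 3 * σ (ι -1ℤ) * + p) P*P≡P^2) ,
    trans deficient≡ (ring-deficient (+ p) (σ (ι -1ℤ))) ,
    trans degree2≡ (ring-2 (+ p) (σ (ι -1ℤ))) ,
    trans degree1≡ (ring-1 (+ p) (σ (ι -1ℤ))) ,
    trans degree0≡ (ring-0 (+ p) (σ (ι -1ℤ)))
    where
    ring-deficient : ∀ P s → 1ℤ * (+ 3 * (P - + 3 + - s)) + -1ℤ * (+ 3 * (1ℤ + 0ℤ)) + 1ℤ * 1ℤ ≡ + 3 * P - + 11 - + 3 * s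
    ring-deficient = solve-∀
    ring-2 : ∀ P s → 1ℤ * (+ 3 * (P - + 3 + - s)) + - + 2 * (+ 3 * (1ℤ + 0ℤ)) + + 3 * 1ℤ ≡ + 3 * (P - + 4 - s)
    ring-2 = solve-∀
    ring-1 : ∀ P s → 0ℤ * (+ 3 * (P - + 3 + - s)) + 1ℤ * (+ 3 * (1ℤ + 0ℤ)) + - + 3 * 1ℤ ≡ 0ℤ
    ring-1 = solve-∀
    ring-0 : ∀ P s → 0ℤ * (+ 3 * (P - + 3 + - s)) + 0ℤ * (+ 3 * (1ℤ + 0ℤ)) + 1ℤ * 1ℤ ≡ 1ℤ
    ring-0 = solve-∀

  -- Here D - 4 = 4 is a square, so the factor χ (D - 4) in the number of vertices is 1.
  vieta-counts-8 :
      let V = vietaGraph (ι (+ 8)); P = + p; s = σ (ι (+ 2)) in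
      ( + order V ≡ P ^ 2 + + 1 + (+ 3 + s) * P
      × + #deficient V ≡ + 3 * (P - + 4 - s + s * φ₂⟨1⟩)
      × + #ofDegree V 2 ≡ + 3 * (P - + 5 - + 2 * s + s * φ₂⟨1⟩)
      × + #ofDegree V 1 ≡ + 3 * (+ 1 + s)
      × + #ofDegree V 0 ≡ + 0 )
  vieta-counts-8 =
    let order≡ , rest = vieta-counts-≢0 (ι (+ 8)) 8≢4 8≢0 χ-8 χ-8-4 legendre-8 in
    trans order≡ (cong (λ k → (+ p) ^ 2 + + 1 + k * + p) (ℤₚ.*-identityʳ (+ 3 + σ (ι (+ 2))))) , rest

theorem13p3 : (p : ℕ) .{{_ : NonZero p}} → Prime p → p ≥ 5 →
  let open Mod p
      P   = + p
      σ₋₁ = σ (ι (- + 1))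
      σ₋₂ = σ (ι (- + 2))
      σ₂  = σ (ι (+ 2))
      V₀  = vietaGraph (ι (+ 0))
      V₋₄ = vietaGraph (ι (- + 4))
      V₂  = vietaGraph (ι (+ 2))
      V₈  = vietaGraph (ι (+ 8))
  in
    ( + order V₀ ≡ P ^ 2 + + 1 + + 3 * σ₋₁ * P
    × + #deficient V₀ ≡ + 3 * P - + 11 - + 3 * σ₋₁
    × + #ofDegree V₀ 2 ≡ + 3 * (P - + 4 - σ₋₁)
    × + #ofDegree V₀ 1 ≡ + 0
    × + #ofDegree V₀ 0 ≡ + 1 )
  ×
    ( + order V₋₄ ≡ P ^ 2 + + 1 + (+ 3 + σ₋₁) * σ₋₂ * P
    × + #deficient V₋₄ ≡ + 3 * (P - + 4 - σ₋₁ + σ₋₂ * φ₂⟨1⟩)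
    × + #ofDegree V₋₄ 2 ≡ + 3 * (P - + 5 - + 2 * σ₋₁ + σ₋₂ * φ₂⟨1⟩)
    × + #ofDegree V₋₄ 1 ≡ + 3 * (+ 1 + σ₋₁)
    × + #ofDegree V₋₄ 0 ≡ + 0 )
  ×
    ( + order V₂ ≡ P ^ 2 + + 1 + (+ 3 + σ₂) * σ₋₂ * P
    × + #deficient V₂ ≡ + 3 * (P - + 4 - σ₂ + φ₂⟨1⟩)
    × + #ofDegree V₂ 2 ≡ + 3 * (P - + 5 - + 2 * σ₂ + φ₂⟨1⟩)
    × + #ofDegree V₂ 1 ≡ + 3 * (+ 1 + σ₂)
    × + #ofDegree V₂ 0 ≡ + 0 )
  ×
    ( + order V₈ ≡ P ^ 2 + + 1 + (+ 3 + σ₂) * P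
    × + #deficient V₈ ≡ + 3 * (P - + 4 - σ₂ + σ₂ * φ₂⟨1⟩)
    × + #ofDegree V₈ 2 ≡ + 3 * (P - + 5 - + 2 * σ₂ + σ₂ * φ₂⟨1⟩)
    × + #ofDegree V₈ 1 ≡ + 3 * (+ 1 + σ₂)
    × + #ofDegree V₈ 0 ≡ + 0 )
theorem13p3 p pr p≥5 =
  vieta-counts-0 ,
  vieta-counts-≢0 (ι (- + 4)) neg4≢4 neg4≢0 χ-neg4 χ-neg4-4 legendre-neg4 ,
  vieta-counts-≢0 (ι (+ 2)) 2≢4 2≢0 refl χ-2-4 legendre-2 ,
  vieta-counts-8
  where
  open Mod p
  open OddFieldWithCharacter (ModularField.primeField p pr p≥5) using (2≢0)
  open CharacterSums (ModularField.primeField p pr p≥5)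
  open VietaGraph p pr p≥5
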